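{- Let $v$ be an integer with $v \geq 7$ if $v$ is odd, and $v \geq 4$ if $v$ is even. If there exists a $\mathrm{TTS}(v)$ with a Hamiltonian $2$-BIG, then there exists a $\mathrm{TTS}(2v+1)$ with a Hamiltonian $2$-BIG.
   Context: A twofold triple system of order $v$, denoted $\mathrm{TTS}(v)$, is a pair $(V,\mathcal{B})$ where $V$ is a set of $v$ points and $\mathcal{B}$ is a collection of $3$-element subsets of $V$ (called blocks or triples; repeated blocks are permitted, i.e. $\mathcal{B}$ is a multiset) such that each $2$-element subset of $V$ is contained in exactly two blocks of $\mathcal{B}$, counted with multiplicity. The $2$-block-intersection graph ($2$-BIG) of $(V,\mathcal{B})$ is the graph whose vertices are the blocks in $\mathcal{B}$ (repeated blocks giving distinct vertices), where two vertices $B_1,B_2$ are adjacent if and only if $|B_1\cap B_2|=2$. A graph is Hamiltonian if it contains a Hamilton cycle (a cycle, of length at least $3$, through all vertices). -}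

module Defs where

open import Data.Fin.Base using (Fin)
open import Data.Fin.Subset using (Subset; ∣_∣; _∩_)
open import Data.Fin.Subset.Properties using (_⊆?_; ∩-comm; ∩-idem)
open import Data.List.Base using (List; _∷_; _∷ʳ_; length; filter; lookup)
open import Data.List.Membership.Propositional using (_∈_)
open import Data.List.Membership.Propositional.Properties using (∈-lookup)
open import Data.List.Relation.Unary.All as All using (All)
open import Data.List.Relation.Unary.Linked using (Linked)
open import Data.List.Relation.Unary.Unique.Propositional using (Unique)
open import Data.Nat.Base using (ℕ; _≤_)
open import Data.Product.Base using (Σ)
open import Relation.Nullary using (¬_)
open import Relation.Binary.PropositionalEquality using (_≡_; sym; trans; cong)

-- The point set is Fin v.  The multiset of blocks is a list, so a repeated
-- block occupies several positions and `filter` counts with multiplicity.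
record TTS (v : ℕ) : Set where
  field
    blocks     : List (Subset v)
    block-size : All (λ B → ∣ B ∣ ≡ 3) blocks
    balanced   : ∀ (P : Subset v) → ∣ P ∣ ≡ 2 →
                 length (filter (P ⊆?_) blocks) ≡ 2

record Graph : Set₁ where
  field
    Vertex  : Set
    Adj     : Vertex → Vertex → Set
    symm    : ∀ {x y} → Adj x y → Adj y x
    irrefl  : ∀ {x} → ¬ Adj x x

-- Vertices are positions in the block list, so that repeated blocks give
-- distinct (and non-adjacent) vertices.
2-BIG : ∀ {v} → TTS v → Graph
2-BIG T = record
  { Vertex = Fin (length blocks)
  ; Adj    = λ i j → ∣ lookup blocks i ∩ lookup blocks j ∣ ≡ 2
  ; symm   = λ {i} {j} e →
      trans (cong ∣_∣ (∩-comm (lookup blocks j) (lookup blocks i))) e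
  ; irrefl = λ {i} e → 3≢2 (trans
      (sym (All.lookup block-size (∈-lookup {xs = blocks} i)))
      (trans (sym (cong ∣_∣ (∩-idem (lookup blocks i)))) e))
  }
  where
  open TTS T
  3≢2 : ¬ (3 ≡ 2)
  3≢2 ()

-- The cycle start, rest₁, …, restₖ, start.
record Cycle (G : Graph) : Set where
  open Graph G
  field
    start : Vertex
    rest  : List Vertex

  vertices : List Vertex
  vertices = start ∷ rest

  field
    distinct : Unique vertices
    length≥3 : 3 ≤ length vertices
    closed   : Linked Adj (vertices ∷ʳ start)

IsHamiltonCycle : (G : Graph) → Cycle G → Set
IsHamiltonCycle G C = ∀ (x : Graph.Vertex G) → x ∈ Cycle.vertices C

Hamiltonian : Graph → Set
Hamiltonian G = Σ (Cycle G) (IsHamiltonCycle G)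

{-# OPTIONS --safe #-}

-- Adjoin to the v points of the old system a set W = ℤ_v ∪ {∞}. The doubled complete graph
-- on W splits into the Hamilton cycles F_s (s ∈ ℤ_v) with edges {u , w}, u + w ∈ {s , s + 1},
-- where a loop at u means {u , ∞}. Labelling the old points i_s, the old blocks together with
-- the blocks {i_s , u , w}, {u , w} ∈ F_s, form a TTS(2v+1). The blocks from one F_s form a
-- cycle in its 2-BIG, and consecutive cycles are joined at the edges through the point 0: the
-- cycle of F_s is run from its edge {0 , s} the long way round to {0 , s + 1}, which also
-- lies in F_{s+1}. The old blocks are still a separate component.
--
-- Let B be a block of the old Hamilton cycle. Its two neighbours B₁ and Bₖ there meet it in
-- different pairs, since a pair lies in only two blocks; so B = {x , y , z} with x, y ∈ B₁ and
-- x, z ∈ Bₖ. Label so that z = i_0, y = i_1, x = i_{v-1}, and put a = 0, b = v - 1, c = 1.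
-- Replacing xyz, xab, yac, zbc by abc, axy, bxz, cyz keeps every pair covered twice, and
--   axy, B₁, …, Bₖ, bxz, F_0 - bc, cyz, F_1 - ac, F_2, …, F_{v-2}, abc, F_{v-1} - ab
-- is a Hamilton cycle. Listing the blocks in this order makes the cycle itself trivial.
module Submission where

open import Defs
open import Data.Bool.Base using (Bool; true; false; if_then_else_; _∧_)
open import Data.Empty using (⊥-elim)
open import Data.Fin.Base as Fin using (Fin; zero; suc)
import Data.Fin.Properties as Finₚ
open import Data.Fin.Subset using (Subset; ∣_∣; _∩_; _⊆_; _∈_)
open import Data.Fin.Subset.Properties using (_⊆?_)
open import Data.List.Base using (List; []; _∷_; _++_; _∷ʳ_; map; length; filter; lookup; allFin; tabulate; last; reverse; initLast; _∷ʳ′_)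
import Data.List.Membership.Propositional as List
open import Data.List.Membership.Propositional.Properties using (∈-allFin; ∈-∃++)
open import Data.List.Membership.Propositional.Properties.WithK using (unique∧set⇒bag)
import Data.List.Properties as Listₚ
open import Data.List.Relation.Binary.BagAndSetEquality using (∼bag⇒↭)
open import Data.List.Relation.Binary.Permutation.Propositional using (_↭_; ↭-refl; ↭-sym; ↭-trans; ↭⇒↭ₛ; prep; module PermutationReasoning)
import Data.List.Relation.Binary.Permutation.Propositional.Properties as ↭ₚ
import Data.List.Relation.Binary.Permutation.Setoid.Properties as ↭ₛₚ
open import Data.List.Relation.Unary.All as All using (All; []; _∷_)
import Data.List.Relation.Unary.All.Properties as Allₚ
open import Data.List.Relation.Unary.AllPairs using ([]; _∷_)
open import Data.List.Relation.Unary.Any using (here; there)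
open import Data.List.Relation.Unary.Linked using (Linked; []; [-]; _∷_)
import Data.List.Relation.Unary.Linked.Properties as Linkedₚ
open import Data.List.Relation.Unary.Unique.Propositional using (Unique)
import Data.List.Relation.Unary.Unique.Propositional.Properties as Uniqueₚ
open import Data.Maybe.Base using (Maybe; just; nothing)
import Data.Maybe.Properties as Maybeₚ
open import Data.Nat.Base using (ℕ; zero; suc; _+_; _*_; _≤_; _<_; _<ᵇ_; z≤n; s≤s)
open import Data.Nat.Divisibility using (_∣_)
open import Data.Nat.ListAction using (sum)
open import Data.Nat.ListAction.Properties using (sum-++; sum-↭)
open import Data.Nat.Properties
open import Algebra.Properties.CommutativeMonoid.Sum +-0-commutativeMonoid using (∑-distrib-+; sum-cong-≗; sum-replicate-zero) renaming (sum to sumᶠ)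
open import Data.Nat.Tactic.RingSolver using (solve-∀)
open import Data.Product.Base using (∃; ∃₂; _×_; _,_; proj₁; proj₂)
open import Data.Sum.Base using (_⊎_; inj₁; inj₂)
import Data.Sum.Properties as Sumₚ
open import Data.Unit.Base using (⊤; tt)
open import Data.Vec.Base as Vec using ([]; _∷_)
import Data.Vec.Properties as Vecₚ
open import Function.Base using (_∘_; id)
open import Function.Bundles using (mk⇔)
open import Relation.Binary.Definitions using (DecidableEquality; tri<; tri≈; tri>)
open import Relation.Binary.PropositionalEquality
open import Relation.Nullary using (¬_; Dec; does; yes; no)
open import Relation.Nullary.Decidable using (dec-true; dec-false)

-- Sums over lists.

∑ : {A : Set} → (A → ℕ) → List A → ℕ
∑ f xs = sum (map f xs)

module _ {A : Set} where
  ∑-++ : ∀ (f : A → ℕ) xs ys → ∑ f (xs ++ ys) ≡ ∑ f xs + ∑ f ys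
  ∑-++ f xs ys = trans (cong sum (Listₚ.map-++ f xs ys)) (sum-++ (map f xs) (map f ys))

  ∑-map : ∀ {B : Set} (f : A → ℕ) (g : B → A) xs → ∑ f (map g xs) ≡ ∑ (f ∘ g) xs
  ∑-map f g xs = cong sum (sym (Listₚ.map-∘ xs))

  ∑-↭ : ∀ (f : A → ℕ) {xs ys} → xs ↭ ys → ∑ f xs ≡ ∑ f ys
  ∑-↭ f p = sum-↭ (↭ₚ.map⁺ f p)

  ∑-cong : ∀ {f g : A → ℕ} {xs} → All (λ x → f x ≡ g x) xs → ∑ f xs ≡ ∑ g xs
  ∑-cong []         = refl
  ∑-cong (eq ∷ eqs) = cong₂ _+_ eq (∑-cong eqs)

  ∑-zero : ∀ {f : A → ℕ} {xs} → All (λ x → f x ≡ 0) xs → ∑ f xs ≡ 0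
  ∑-zero []         = refl
  ∑-zero (eq ∷ eqs) = cong₂ _+_ eq (∑-zero eqs)

-- Triples, incidence counts and the systems to be built.

Triple : Set → Set
Triple A = A × A × A

Distinct : {A : Set} → Triple A → Set
Distinct (a , b , c) = a ≢ b × a ≢ c × b ≢ c

bit : Bool → ℕ
bit b = if b then 1 else 0

module Incidence {A : Set} (_≟_ : DecidableEquality A) where

  ι : A → A → ℕ
  ι x y = bit (does (x ≟ y))

  -- A number and not a truth value: block counts become polynomials in the indicators `ι`, and
  -- exchanges of blocks become ring identities.
  mem : A → Triple A → ℕ
  mem k (a , b , c) = ι k a + ι k b + ι k c

  covers : A → A → Triple A → ℕ
  covers p q t = mem p t * mem q t

  common : Triple A → Triple A → ℕ
  common (a , b , c) t = mem a t + mem b t + mem c t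

  Meet₂ : Triple A → Triple A → Set
  Meet₂ t u = common t u ≡ 2

  ι-refl : ∀ x → ι x x ≡ 1
  ι-refl x = cong bit (dec-true (x ≟ x) refl)

  ι-≢ : ∀ {x y} → x ≢ y → ι x y ≡ 0
  ι-≢ {x} {y} x≢y = cong bit (dec-false (x ≟ y) x≢y)

  ι-sym : ∀ x y → ι x y ≡ ι y x
  ι-sym x y with x ≟ y
  ... | yes refl = sym (ι-refl x)
  ... | no x≢y   = sym (ι-≢ (x≢y ∘ sym))

  ι-exclusive : ∀ {p q} → p ≢ q → ∀ x → ι p x * ι q x ≡ 0
  ι-exclusive {p} {q} p≢q x with p ≟ x
  ... | yes refl = trans (+-identityʳ (ι q p)) (ι-≢ (p≢q ∘ sym))
  ... | no _     = refl

  ∑ι-∉ : ∀ {p xs} → All (p ≢_) xs → ∑ (ι p) xs ≡ 0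
  ∑ι-∉ []          = refl
  ∑ι-∉ (px ∷ pxs) = cong₂ _+_ (ι-≢ px) (∑ι-∉ pxs)

  common-sym : ∀ t u → common t u ≡ common u t
  common-sym (a , b , c) (x , y , z)
    rewrite ι-sym a x | ι-sym a y | ι-sym a z
          | ι-sym b x | ι-sym b y | ι-sym b z
          | ι-sym c x | ι-sym c y | ι-sym c z =
    transpose (ι x a) (ι x b) (ι x c) (ι y a) (ι y b) (ι y c) (ι z a) (ι z b) (ι z c)
    where
    transpose : ∀ m₁ m₂ m₃ n₁ n₂ n₃ o₁ o₂ o₃ →
      m₁ + n₁ + o₁ + (m₂ + n₂ + o₂) + (m₃ + n₃ + o₃) ≡
      m₁ + m₂ + m₃ + (n₁ + n₂ + n₃) + (o₁ + o₂ + o₃)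
    transpose = solve-∀

  mem-fst : ∀ {a b c} → Distinct (a , b , c) → mem a (a , b , c) ≡ 1
  mem-fst {a} (a≢b , a≢c , _) rewrite ι-refl a | ι-≢ a≢b | ι-≢ a≢c = refl

  mem-snd : ∀ {a b c} → Distinct (a , b , c) → mem b (a , b , c) ≡ 1
  mem-snd {b = b} (a≢b , _ , b≢c) rewrite ι-refl b | ι-≢ (a≢b ∘ sym) | ι-≢ b≢c = refl

  mem-thd : ∀ {a b c} → Distinct (a , b , c) → mem c (a , b , c) ≡ 1
  mem-thd {c = c} (_ , a≢c , b≢c) rewrite ι-refl c | ι-≢ (a≢c ∘ sym) | ι-≢ (b≢c ∘ sym) = refl

  mem-out : ∀ k a b c → k ≢ a → k ≢ b → k ≢ c → mem k (a , b , c) ≡ 0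
  mem-out k a b c k≢a k≢b k≢c rewrite ι-≢ k≢a | ι-≢ k≢b | ι-≢ k≢c = refl

  mem≤1 : ∀ k {t} → Distinct t → mem k t ≤ 1
  mem≤1 k {a , b , c} d@(a≢b , a≢c , b≢c) with k ≟ a
  ... | yes refl rewrite ι-≢ a≢b | ι-≢ a≢c = s≤s z≤n
  ... | no _ with k ≟ b
  ... | yes refl rewrite ι-≢ b≢c = s≤s z≤n
  ... | no _ with k ≟ c
  ... | yes _ = s≤s z≤n
  ... | no _  = z≤n

  -- A twofold triple system whose blocks are listed along a Hamilton cycle of its
  -- 2-block-intersection graph; only the points satisfying Valid belong to it.
  record HamiltonTTS (Valid : A → Set) : Set where
    field
      first    : Triple A
      rest     : List (Triple A)

    blocks : List (Triple A)
    blocks = first ∷ rest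

    field
      valid    : All (λ { (a , b , c) → Valid a × Valid b × Valid c }) blocks
      distinct : All Distinct blocks
      length≥3 : 3 ≤ length blocks
      cyclic   : Linked Meet₂ (blocks ∷ʳ first)
      balanced : ∀ {p q} → Valid p → Valid q → p ≢ q → ∑ (covers p q) blocks ≡ 2

-- Translation between lists of triples and systems of subsets.

linked-map : {A : Set} {P : A → Set} {R S : A → A → Set} →
  (∀ {x y} → P x → P y → R x y → S x y) →
  ∀ {xs} → All P xs → Linked R xs → Linked S xs
linked-map f _              []       = []
linked-map f _              [-]      = [-]
linked-map f (px ∷ py ∷ ps) (r ∷ rs) = f px py r ∷ linked-map f (py ∷ ps) rs

length-filter : {A : Set} {P : A → Set} (P? : ∀ x → Dec (P x)) → ∀ xs →
  length (filter P? xs) ≡ ∑ (λ x → bit (does (P? x))) xs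
length-filter P? []       = refl
length-filter P? (x ∷ xs) with does (P? x)
... | true  = cong suc (length-filter P? xs)
... | false = length-filter P? xs

χ : ∀ {m} → Subset m → Fin m → ℕ
χ S i = bit (Vec.lookup S i)

χ≤1 : ∀ {m} (S : Subset m) i → χ S i ≤ 1
χ≤1 S i with Vec.lookup S i
... | true  = s≤s z≤n
... | false = z≤n

χ-∩ : ∀ {m} (S U : Subset m) i → χ (S ∩ U) i ≡ χ S i * χ U i
χ-∩ S U i rewrite Vecₚ.lookup-zipWith _∧_ i S U = bit-∧ (Vec.lookup S i) (Vec.lookup U i)
  where
  bit-∧ : ∀ b c → bit (b ∧ c) ≡ bit b * bit c
  bit-∧ true  c = sym (+-identityʳ (bit c))
  bit-∧ false c = refl

∣∣≡sum-χ : ∀ {m} (S : Subset m) → ∣ S ∣ ≡ sumᶠ (χ S)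
∣∣≡sum-χ []          = refl
∣∣≡sum-χ (true ∷ S)  = cong suc (∣∣≡sum-χ S)
∣∣≡sum-χ (false ∷ S) = ∣∣≡sum-χ S

χ-injective : ∀ {m} {S U : Subset m} → (∀ i → χ S i ≡ χ U i) → S ≡ U
χ-injective {S = []}    {[]}    eq = refl
χ-injective {S = s ∷ S} {u ∷ U} eq = cong₂ _∷_ (bit-injective s u (eq zero)) (χ-injective (eq ∘ suc))
  where
  bit-injective : ∀ b c → bit b ≡ bit c → b ≡ c
  bit-injective true  true  _ = refl
  bit-injective false false _ = refl

module _ {m : ℕ} where
  open Incidence (Finₚ._≟_ {m}) public using () renaming
    ( ι to ιᶠ; mem to memᶠ; covers to coversᶠ; common to commonᶠ; Meet₂ to Meet₂ᶠ
    ; mem≤1 to memᶠ≤1; mem-fst to memᶠ-fst; mem-snd to memᶠ-snd; mem-thd to memᶠ-thd; common-sym to commonᶠ-sym; ι-refl to ιᶠ-refl; ι-≢ to ιᶠ-≢; HamiltonTTS to HamiltonTTSᶠ)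

sum-sift : ∀ {m} (a : Fin m) (f : Fin m → ℕ) → sumᶠ (λ i → ιᶠ i a * f i) ≡ f a
sum-sift {suc m} zero    f = trans (cong₂ _+_ (+-identityʳ (f zero)) (sum-replicate-zero m)) (+-identityʳ (f zero))
sum-sift {suc m} (suc a) f = sum-sift a (f ∘ suc)

-- Each indicator sifts out one value of `f`. The constant 1 yields the size of a block, and
-- membership in a second block yields the size of the intersection.
sum-mem : ∀ {m} (t : Triple (Fin m)) (f : Fin m → ℕ) →
  let (a , b , c) = t in sumᶠ (λ i → memᶠ i t * f i) ≡ f a + f b + f c
sum-mem (a , b , c) f = begin
  sumᶠ (λ i → (ιᶠ i a + ιᶠ i b + ιᶠ i c) * f i)
    ≡⟨ sum-cong-≗ (λ i → distrib (ιᶠ i a) (ιᶠ i b) (ιᶠ i c) (f i)) ⟩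
  sumᶠ (λ i → ιᶠ i a * f i + ιᶠ i b * f i + ιᶠ i c * f i)
    ≡⟨ ∑-distrib-+ (λ i → ιᶠ i a * f i + ιᶠ i b * f i) _ ⟩
  sumᶠ (λ i → ιᶠ i a * f i + ιᶠ i b * f i) + sumᶠ (λ i → ιᶠ i c * f i)
    ≡⟨ cong (_+ sumᶠ (λ i → ιᶠ i c * f i)) (∑-distrib-+ (λ i → ιᶠ i a * f i) _) ⟩
  sumᶠ (λ i → ιᶠ i a * f i) + sumᶠ (λ i → ιᶠ i b * f i) + sumᶠ (λ i → ιᶠ i c * f i)
    ≡⟨ cong₂ _+_ (cong₂ _+_ (sum-sift a f) (sum-sift b f)) (sum-sift c f) ⟩
  f a + f b + f c ∎
  where
  open ≡-Reasoning
  distrib : ∀ x y z w → (x + y + z) * w ≡ x * w + y * w + z * w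
  distrib = solve-∀

toSubset : ∀ {m} → Triple (Fin m) → Subset m
toSubset t = Vec.tabulate (λ i → 0 <ᵇ memᶠ i t)

χ-toSubset : ∀ {m} {t : Triple (Fin m)} → Distinct t → ∀ i → χ (toSubset t) i ≡ memᶠ i t
χ-toSubset {t = t} d i = trans (cong bit (Vecₚ.lookup∘tabulate _ i)) (positive (memᶠ≤1 i d))
  where
  positive : ∀ {n} → n ≤ 1 → bit (0 <ᵇ n) ≡ n
  positive z≤n       = refl
  positive (s≤s z≤n) = refl

∣toSubset∣ : ∀ {m} {t : Triple (Fin m)} → Distinct t → ∣ toSubset t ∣ ≡ 3
∣toSubset∣ {t = t} d = begin
  ∣ toSubset t ∣              ≡⟨ ∣∣≡sum-χ (toSubset t) ⟩
  sumᶠ (χ (toSubset t))       ≡⟨ sum-cong-≗ (λ i → trans (χ-toSubset d i) (sym (*-identityʳ _))) ⟩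
  sumᶠ (λ i → memᶠ i t * 1)   ≡⟨ sum-mem t (λ _ → 1) ⟩
  3                           ∎
  where open ≡-Reasoning

∣toSubset∩toSubset∣ : ∀ {m} {t u : Triple (Fin m)} → Distinct t → Distinct u →
  ∣ toSubset t ∩ toSubset u ∣ ≡ commonᶠ t u
∣toSubset∩toSubset∣ {t = t} {u} d e = begin
  ∣ toSubset t ∩ toSubset u ∣           ≡⟨ ∣∣≡sum-χ (toSubset t ∩ toSubset u) ⟩
  sumᶠ (χ (toSubset t ∩ toSubset u))
    ≡⟨ sum-cong-≗ (λ i → trans (χ-∩ (toSubset t) (toSubset u) i) (cong₂ _*_ (χ-toSubset d i) (χ-toSubset e i))) ⟩
  sumᶠ (λ i → memᶠ i t * memᶠ i u)      ≡⟨ sum-mem t (λ i → memᶠ i u) ⟩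
  commonᶠ t u                           ∎
  where open ≡-Reasoning

-- The least element is split off. That it does not lie in `U` is not recorded, as it can be
-- recovered from the equation and `χ≤1`.
extract : ∀ {m k} (S : Subset m) → ∣ S ∣ ≡ suc k →
  ∃₂ λ p U → ∣ U ∣ ≡ k × (∀ i → χ S i ≡ ιᶠ i p + χ U i)
extract (true ∷ S)  eq = zero , false ∷ S , suc-injective eq , λ { zero → refl ; (suc i) → refl }
extract (false ∷ S) eq with extract S eq
... | p , U , ∣U∣ , χS = suc p , false ∷ U , ∣U∣ , λ { zero → refl ; (suc i) → χS i }

∣∣≡0⇒χ≡0 : ∀ {m} (S : Subset m) → ∣ S ∣ ≡ 0 → ∀ i → χ S i ≡ 0
∣∣≡0⇒χ≡0 (false ∷ S) eq zero    = refl
∣∣≡0⇒χ≡0 (false ∷ S) eq (suc i) = ∣∣≡0⇒χ≡0 S eq i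

extract₂ : ∀ {m} (P : Subset m) → ∣ P ∣ ≡ 2 →
  ∃₂ λ p q → p ≢ q × (∀ i → χ P i ≡ ιᶠ i p + ιᶠ i q)
extract₂ P eq with extract P eq
... | p , P′ , eq′ , χP with extract P′ eq′
... | q , P″ , eq″ , χP′ = p , q , p≢q , χ≡
  where
  χ≡ : ∀ i → χ P i ≡ ιᶠ i p + ιᶠ i q
  χ≡ i = trans (χP i) (cong (ιᶠ i p +_)
    (trans (χP′ i) (trans (cong (ιᶠ i q +_) (∣∣≡0⇒χ≡0 P″ eq″ i)) (+-identityʳ _))))
  p≢q : p ≢ q
  -- Equal points would give `χ P p` the value 2.
  p≢q refl with subst (_≤ 1) (trans (χ≡ p) (cong₂ _+_ (ιᶠ-refl p) (ιᶠ-refl p))) (χ≤1 P p)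
  ... | s≤s ()

extract₃ : ∀ {m} (S : Subset m) → ∣ S ∣ ≡ 3 → ∃ λ t → Distinct t × S ≡ toSubset t
extract₃ S eq with extract S eq
... | a , S′ , eq′ , χS with extract₂ S′ eq′
... | b , c , b≢c , χS′ = (a , b , c) , dist , χ-injective (λ i → trans (χ≡ i) (sym (χ-toSubset dist i)))
  where
  χ≡ : ∀ i → χ S i ≡ memᶠ i (a , b , c)
  χ≡ i = trans (χS i) (trans (cong (ιᶠ i a +_) (χS′ i)) (sym (+-assoc (ιᶠ i a) (ιᶠ i b) (ιᶠ i c))))
  a∉S′ : χ S′ a ≡ 0
  a∉S′ with χ S′ a | subst (_≤ 1) (trans (χS a) (cong (_+ χ S′ a) (ιᶠ-refl a))) (χ≤1 S a)
  ... | zero | _ = refl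
  ... | suc _ | s≤s ()
  a∉bc : ιᶠ a b + ιᶠ a c ≡ 0
  a∉bc = trans (sym (χS′ a)) a∉S′
  a≢b : a ≢ b
  a≢b refl with trans (sym (ιᶠ-refl a)) (m+n≡0⇒m≡0 (ιᶠ a a) a∉bc)
  ... | ()
  a≢c : a ≢ c
  a≢c refl with trans (sym (ιᶠ-refl a)) (m+n≡0⇒n≡0 (ιᶠ a b) a∉bc)
  ... | ()
  dist : Distinct (a , b , c)
  dist = a≢b , a≢c , b≢c

-- Testing the inclusion of a pair is multiplying two indicators, which links the `filter` in the
-- definition of a system to `covers`.
pair-⊆? : ∀ {m} (P : Subset m) {p q} → (∀ i → χ P i ≡ ιᶠ i p + ιᶠ i q) → ∀ S →
  bit (does (P ⊆? S)) ≡ χ S p * χ S q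
pair-⊆? P {p} {q} χP S with Vec.lookup S p in eqp | Vec.lookup S q in eqq
... | true | true = cong bit (dec-true (P ⊆? S) P⊆S)
  where
  P⊆S : P ⊆ S
  P⊆S {x} x∈P with x Finₚ.≟ p | x Finₚ.≟ q | χP x
  ... | yes refl | _        | _ = Vecₚ.lookup⇒[]= x S eqp
  ... | no _     | yes refl | _ = Vecₚ.lookup⇒[]= x S eqq
  ... | no x≢p   | no x≢q   | e with trans (sym (cong bit (Vecₚ.[]=⇒lookup x∈P))) e
  ... | ()
... | true | false = cong bit (dec-false (P ⊆? S) λ P⊆S → absurd (P⊆S q∈P))
  where
  q∈P : q ∈ P
  q∈P = Vecₚ.lookup⇒[]= q P (positive (trans (χP q) (trans (cong (ιᶠ q p +_) (ιᶠ-refl q)) (+-comm _ 1))))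
    where
    positive : ∀ {b n} → bit b ≡ suc n → b ≡ true
    positive {true} _ = refl
  absurd : ¬ (q ∈ S)
  absurd q∈S with trans (sym eqq) (Vecₚ.[]=⇒lookup q∈S)
  ... | ()
... | false | _ = cong bit (dec-false (P ⊆? S) λ P⊆S → absurd (P⊆S p∈P))
  where
  p∈P : p ∈ P
  p∈P = Vecₚ.lookup⇒[]= p P (positive (trans (χP p) (cong (_+ ιᶠ p q) (ιᶠ-refl p))))
    where
    positive : ∀ {b n} → bit b ≡ suc n → b ≡ true
    positive {true} _ = refl
  absurd : ¬ (p ∈ S)
  absurd p∈S with trans (sym eqp) (Vecₚ.[]=⇒lookup p∈S)
  ... | ()

count-pair : ∀ {m} (P : Subset m) {p q} → (∀ i → χ P i ≡ ιᶠ i p + ιᶠ i q) →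
  ∀ {ts} → All Distinct ts →
  length (filter (P ⊆?_) (map toSubset ts)) ≡ ∑ (coversᶠ p q) ts
count-pair P {p} {q} χP {ts} ds = begin
  length (filter (P ⊆?_) (map toSubset ts))              ≡⟨ length-filter (P ⊆?_) (map toSubset ts) ⟩
  ∑ (λ S → bit (does (P ⊆? S))) (map toSubset ts)        ≡⟨ ∑-map (λ S → bit (does (P ⊆? S))) toSubset ts ⟩
  ∑ (λ t → bit (does (P ⊆? toSubset t))) ts
    ≡⟨ ∑-cong (All.map (λ d → trans (pair-⊆? P χP (toSubset _)) (cong₂ _*_ (χ-toSubset d p) (χ-toSubset d q))) ds) ⟩
  ∑ (coversᶠ p q) ts                                     ∎
  where open ≡-Reasoning

-- Since the blocks are listed along the cycle, the positions in their natural order form the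
-- Hamilton cycle, and they stay distinct when blocks repeat.
HamiltonTTS⇒TTS : ∀ {m} → HamiltonTTSᶠ {m} (λ _ → ⊤) → ∃ λ (T : TTS m) → Hamiltonian (2-BIG T)
HamiltonTTS⇒TTS {m} H = T , C , λ x → ∈-allFin x
  where
  open Incidence.HamiltonTTS H
  T : TTS m
  T = record
    { blocks     = map toSubset blocks
    ; block-size = Allₚ.map⁺ (All.map ∣toSubset∣ distinct)
    ; balanced   = λ P ∣P∣≡2 →
        let (p , q , p≢q , χP) = extract₂ P ∣P∣≡2
        in trans (count-pair P χP distinct) (balanced tt tt p≢q)
    }
  N : ℕ
  N = length (map toSubset blocks)
  lookups : map (lookup (map toSubset blocks)) (allFin N ∷ʳ zero) ≡ map toSubset (blocks ∷ʳ first)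
  lookups = begin
    map (lookup (map toSubset blocks)) (allFin N ∷ʳ zero)
      ≡⟨ Listₚ.map-++ _ (allFin N) (zero ∷ []) ⟩
    map (lookup (map toSubset blocks)) (allFin N) ∷ʳ toSubset first
      ≡⟨ cong (_∷ʳ toSubset first) (trans (Listₚ.map-tabulate id _) (Listₚ.tabulate-lookup (map toSubset blocks))) ⟩
    map toSubset blocks ∷ʳ toSubset first
      ≡⟨ Listₚ.map-++ toSubset blocks (first ∷ []) ⟨
    map toSubset (blocks ∷ʳ first) ∎
    where open ≡-Reasoning
  C : Cycle (2-BIG T)
  C = record
    { start    = zero
    ; rest     = tabulate suc
    ; distinct = Uniqueₚ.allFin⁺ N
    ; length≥3 = subst (3 ≤_) (sym (trans (Listₚ.length-tabulate id) (Listₚ.length-map toSubset blocks))) length≥3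
    ; closed   = Linkedₚ.map⁻ (subst (Linked (λ S U → ∣ S ∩ U ∣ ≡ 2)) (sym lookups)
        (Linkedₚ.map⁺ (linked-map (λ d e r → trans (∣toSubset∩toSubset∣ d e) r)
          (Allₚ.∷ʳ⁺ distinct (All.head distinct)) cyclic)))
    }

All-extract₃ : ∀ {m} {Ss : List (Subset m)} → All (λ S → ∣ S ∣ ≡ 3) Ss →
  ∃ λ ts → All Distinct ts × Ss ≡ map toSubset ts
All-extract₃ []         = [] , [] , refl
All-extract₃ {Ss = S ∷ _} (eq ∷ eqs) with extract₃ S eq | All-extract₃ eqs
... | t , d , eqt | ts , ds , eqts = t ∷ ts , d ∷ ds , cong₂ _∷_ eqt eqts

∃-pair : ∀ {m} {p q : Fin m} → p ≢ q →
  ∃ λ (P : Subset m) → ∣ P ∣ ≡ 2 × (∀ i → χ P i ≡ ιᶠ i p + ιᶠ i q)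
∃-pair {m} {p} {q} p≢q = P , ∣P∣ , χP
  where
  open ≡-Reasoning
  P : Subset m
  P = Vec.tabulate (λ i → 0 <ᵇ ιᶠ i p + ιᶠ i q)
  χP : ∀ i → χ P i ≡ ιᶠ i p + ιᶠ i q
  χP i = trans (cong bit (Vecₚ.lookup∘tabulate _ i)) positive
    where
    positive : bit (0 <ᵇ ιᶠ i p + ιᶠ i q) ≡ ιᶠ i p + ιᶠ i q
    positive with i Finₚ.≟ p | i Finₚ.≟ q
    ... | yes refl | yes refl = ⊥-elim (p≢q refl)
    ... | yes _    | no _     = refl
    ... | no _     | yes _    = refl
    ... | no _     | no _     = refl
  ∣P∣ : ∣ P ∣ ≡ 2
  ∣P∣ = begin
    ∣ P ∣                                     ≡⟨ ∣∣≡sum-χ P ⟩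
    sumᶠ (χ P)                                ≡⟨ sum-cong-≗ (λ i → trans (χP i) (sym (cong₂ _+_ (*-identityʳ (ιᶠ i p)) (*-identityʳ (ιᶠ i q))))) ⟩
    sumᶠ (λ i → ιᶠ i p * 1 + ιᶠ i q * 1)      ≡⟨ ∑-distrib-+ (λ i → ιᶠ i p * 1) _ ⟩
    sumᶠ (λ i → ιᶠ i p * 1) + sumᶠ (λ i → ιᶠ i q * 1)  ≡⟨ cong₂ _+_ (sum-sift p (λ _ → 1)) (sum-sift q (λ _ → 1)) ⟩
    2                                         ∎

-- The blocks are reordered along the given cycle. Pair counts survive because the cycle visits
-- every position exactly once, so its vertices are a permutation of all positions.
TTS⇒HamiltonTTS : ∀ {m} → (∃ λ (T : TTS m) → Hamiltonian (2-BIG T)) → HamiltonTTSᶠ {m} (λ _ → ⊤)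
TTS⇒HamiltonTTS {m} (T , C , complete) = fromTriples (All-extract₃ sizes)
  where
  open TTS T
  open Cycle C using (start; vertices)
  ordered : List (Subset m)
  ordered = map (lookup blocks) vertices
  vertices↭ : vertices ↭ allFin (length blocks)
  vertices↭ = ∼bag⇒↭ (unique∧set⇒bag (Cycle.distinct C) (Uniqueₚ.allFin⁺ _)
    (λ {x} → mk⇔ (λ _ → ∈-allFin x) (λ _ → complete x)))
  ordered↭ : ordered ↭ blocks
  ordered↭ = subst (ordered ↭_) (trans (Listₚ.map-tabulate id _) (Listₚ.tabulate-lookup blocks))
    (↭ₚ.map⁺ (lookup blocks) vertices↭)
  sizes : All (λ S → ∣ S ∣ ≡ 3) ordered
  sizes = ↭ₚ.All-resp-↭ (↭-sym ordered↭) block-size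
  closed : Linked (λ S U → ∣ S ∩ U ∣ ≡ 2) (ordered ∷ʳ lookup blocks start)
  closed = subst (Linked _) (Listₚ.map-++ (lookup blocks) vertices (start ∷ [])) (Linkedₚ.map⁺ (Cycle.closed C))
  counts : ∀ P → ∣ P ∣ ≡ 2 → length (filter (P ⊆?_) ordered) ≡ 2
  counts P ∣P∣≡2 = trans (↭ₚ.↭-length (↭ₚ.filter-↭ (P ⊆?_) ordered↭)) (balanced P ∣P∣≡2)
  len : 3 ≤ length ordered
  len = subst (3 ≤_) (sym (Listₚ.length-map (lookup blocks) vertices)) (Cycle.length≥3 C)
  fromTriples : (∃ λ ts → All Distinct ts × ordered ≡ map toSubset ts) → HamiltonTTSᶠ (λ _ → ⊤)
  -- The list cannot be empty, as `ordered` begins with the block at `start`.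
  fromTriples (t ∷ ts , ds , eq) = record
    { first    = t
    ; rest     = ts
    ; valid    = All.universal _ (t ∷ ts)
    ; distinct = ds
    ; length≥3 = subst (3 ≤_) (trans (cong length eq) (Listₚ.length-map toSubset (t ∷ ts))) len
    ; cyclic   = linked-map (λ d e r → trans (sym (∣toSubset∩toSubset∣ d e)) r)
        (Allₚ.∷ʳ⁺ ds (All.head ds))
        (Linkedₚ.map⁻ (subst (Linked _)
          (trans (cong₂ _∷ʳ_ eq (Listₚ.∷-injectiveˡ eq)) (sym (Listₚ.map-++ toSubset (t ∷ ts) (t ∷ [])))) closed))
    ; balanced = λ _ _ p≢q →
        let (P , ∣P∣≡2 , χP) = ∃-pair p≢q
        in trans (sym (count-pair P χP ds)) (trans (cong (length ∘ filter (P ⊆?_)) (sym eq)) (counts P ∣P∣≡2))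
    }

-- Sums over the edges of a walk.

module _ {B : Set} where

  wsum : (B → B → ℕ) → List B → ℕ
  wsum g []           = 0
  wsum g (u ∷ [])     = 0
  wsum g (u ∷ v ∷ ws) = g u v + wsum g (v ∷ ws)

  -- The walk is cut at the vertex `y`, which belongs to both pieces, so that no edge is lost.
  wsum-++ : ∀ g xs y ys → wsum g (xs ++ y ∷ ys) ≡ wsum g (xs ∷ʳ y) + wsum g (y ∷ ys)
  wsum-++ g []            y ys = refl
  wsum-++ g (x ∷ [])      y ys = cong (_+ wsum g (y ∷ ys)) (sym (+-identityʳ (g x y)))
  wsum-++ g (x ∷ x′ ∷ xs) y ys =
    trans (cong (g x x′ +_) (wsum-++ g (x′ ∷ xs) y ys)) (sym (+-assoc (g x x′) _ _))

  wsum-reverse : ∀ g → (∀ u v → g u v ≡ g v u) → ∀ xs → wsum g (reverse xs) ≡ wsum g xs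
  wsum-reverse g g-sym []           = refl
  wsum-reverse g g-sym (x ∷ [])     = refl
  wsum-reverse g g-sym (x ∷ y ∷ xs) = begin
    wsum g (reverse (x ∷ y ∷ xs))                   ≡⟨ cong (wsum g) (Listₚ.unfold-reverse x (y ∷ xs)) ⟩
    wsum g (reverse (y ∷ xs) ∷ʳ x)                  ≡⟨ cong (λ zs → wsum g (zs ∷ʳ x)) (Listₚ.unfold-reverse y xs) ⟩
    wsum g ((reverse xs ∷ʳ y) ∷ʳ x)                 ≡⟨ cong (wsum g) (Listₚ.++-assoc (reverse xs) (y ∷ []) (x ∷ [])) ⟩
    wsum g (reverse xs ++ y ∷ x ∷ [])               ≡⟨ wsum-++ g (reverse xs) y (x ∷ []) ⟩
    wsum g (reverse xs ∷ʳ y) + (g y x + 0)          ≡⟨ cong₂ _+_ (cong (wsum g) (sym (Listₚ.unfold-reverse y xs))) (trans (+-identityʳ _) (g-sym y x)) ⟩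
    wsum g (reverse (y ∷ xs)) + g x y               ≡⟨ cong (_+ g x y) (wsum-reverse g g-sym (y ∷ xs)) ⟩
    wsum g (y ∷ xs) + g x y                         ≡⟨ +-comm _ (g x y) ⟩
    g x y + wsum g (y ∷ xs)                         ∎
    where open ≡-Reasoning

  wsum-cong : ∀ {g h : B → B → ℕ} → (∀ u v → g u v ≡ h u v) → ∀ ws → wsum g ws ≡ wsum h ws
  wsum-cong eq []           = refl
  wsum-cong eq (u ∷ [])     = refl
  wsum-cong eq (u ∷ v ∷ ws) = cong₂ _+_ (eq u v) (wsum-cong eq (v ∷ ws))

  -- An inner position of a walk lies on two of its edges, an end on one.
  wsum-degrees : ∀ (f : B → ℕ) x xs y →
    wsum (λ u v → f u + f v) (x ∷ xs ∷ʳ y) ≡ f x + f y + 2 * ∑ f xs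
  wsum-degrees f x []        y = refl
  wsum-degrees f x (x′ ∷ xs) y =
    trans (cong (f x + f x′ +_) (wsum-degrees f x′ xs y)) (regroup (f x) (f x′) (f y) (∑ f xs))
    where
    regroup : ∀ a b c s → a + b + (b + c + 2 * s) ≡ a + c + 2 * (b + s)
    regroup = solve-∀

  -- For the indicators `P` and `Q` of two different points, each product is 1 on the edge joining
  -- them and 0 elsewhere, so this counts how often the walk uses that edge.
  pairs : (P Q : B → ℕ) → List B → ℕ
  pairs P Q = wsum (λ u v → (P u + P v) * (Q u + Q v))

  pairs-zeroˡ : ∀ P Q {ws} → All (λ u → P u ≡ 0) ws → pairs P Q ws ≡ 0
  pairs-zeroˡ P Q []                         = refl
  pairs-zeroˡ P Q (_ ∷ [])                   = refl
  pairs-zeroˡ P Q {u ∷ v ∷ _} (pu ∷ pv ∷ ps) =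
    cong₂ _+_ (cong (_* (Q u + Q v)) (cong₂ _+_ pu pv)) (pairs-zeroˡ P Q (pv ∷ ps))

  pairs-comm : ∀ P Q ws → pairs P Q ws ≡ pairs Q P ws
  pairs-comm P Q = wsum-cong (λ u v → *-comm (P u + P v) (Q u + Q v))

  pairs-reverse : ∀ P Q ws → pairs P Q (reverse ws) ≡ pairs P Q ws
  pairs-reverse P Q = wsum-reverse _ (λ u v → cong₂ _*_ (+-comm (P u) (P v)) (+-comm (Q u) (Q v)))

-- Intervals and the zigzags through them.

range : ℕ → ℕ → List ℕ
range l zero    = []
range l (suc k) = l ∷ range (suc l) k

range-++ : ∀ l s r → range l (s + r) ≡ range l s ++ range (l + s) r
range-++ l zero    r = cong (λ z → range z r) (sym (+-identityʳ l))
range-++ l (suc s) r = cong (l ∷_) (trans (range-++ (suc l) s r) (cong (λ z → range (suc l) s ++ range z r) (sym (+-suc l s))))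

range-∷ʳ : ∀ l k → range l k ∷ʳ (l + k) ≡ range l (suc k)
range-∷ʳ l k = trans (sym (range-++ l k 1)) (cong (range l) (+-comm k 1))

range-bounds : ∀ l k → All (λ u → l ≤ u × u < l + k) (range l k)
range-bounds l zero    = []
range-bounds l (suc k) = (≤-refl , m<m+n l (s≤s z≤n)) ∷
  All.map (λ { {u} (l<u , u<) → <⇒≤ l<u , subst (u <_) (sym (+-suc l k)) u< }) (range-bounds (suc l) k)

range-unique : ∀ l k → Unique (range l k)
range-unique l zero    = []
range-unique l (suc k) = All.map (λ { (l<u , _) → <⇒≢ l<u }) (range-bounds (suc l) k) ∷ range-unique (suc l) k

-- zigU l k and zigD l k list the interval [l , l + k) from the outside inwards, alternating
-- between its two ends; zigU starts at the lower end and zigD at the upper one.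
zigU zigD : ℕ → ℕ → List ℕ
zigU l zero    = []
zigU l (suc k) = l ∷ zigD (suc l) k
zigD l zero    = []
zigD l (suc k) = l + k ∷ zigU l k

zigU↭range : ∀ l k → zigU l k ↭ range l k
zigD↭range : ∀ l k → zigD l k ↭ range l k
zigU↭range l zero    = ↭-refl
zigU↭range l (suc k) = prep l (zigD↭range (suc l) k)
zigD↭range l zero    = ↭-refl
zigD↭range l (suc k) = subst (zigD l (suc k) ↭_) (range-∷ʳ l k)
  (↭-trans (prep (l + k) (zigU↭range l k)) (↭ₚ.∷↭∷ʳ (l + k) (range l k)))

zigU-bounds : ∀ l k → All (λ u → l ≤ u × u < l + k) (zigU l k)
zigU-bounds l k = ↭ₚ.All-resp-↭ (↭-sym (zigU↭range l k)) (range-bounds l k)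

zigD-bounds : ∀ l k → All (λ u → l ≤ u × u < l + k) (zigD l k)
zigD-bounds l k = ↭ₚ.All-resp-↭ (↭-sym (zigD↭range l k)) (range-bounds l k)

-- Edges used by a zigzag that ends at `∞`.

pattern pt n = just n
pattern ∞ = nothing

open Incidence _≟_ using () renaming
  (ι to ιⁿ; ι-refl to ιⁿ-refl; ι-≢ to ιⁿ-≢; ι-sym to ιⁿ-sym; ι-exclusive to ιⁿ-exclusive; ∑ι-∉ to ∑ιⁿ-∉)
module Iʷ = Incidence (Maybeₚ.≡-dec _≟_)
open Iʷ using () renaming (ι to ιʷ)

ιⁿ-+ˡ : ∀ l m n → ιⁿ (l + m) (l + n) ≡ ιⁿ m n
ιⁿ-+ˡ zero    m n = refl
ιⁿ-+ˡ (suc l) m n = ιⁿ-+ˡ l m n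

avoid : ∀ {p xs} → All (p ≢_) xs → All (λ u → ιʷ (pt p) u ≡ 0) (map pt xs ++ ∞ ∷ [])
avoid all = Allₚ.++⁺ (Allₚ.map⁺ (All.map ιⁿ-≢ all)) (refl ∷ [])

below : ∀ {p l k} → p < l → ∀ {xs} → All (λ u → l ≤ u × u < l + k) xs → All (p ≢_) xs
below p<l = All.map (λ { (l≤u , _) → <⇒≢ (<-≤-trans p<l l≤u) })

above : ∀ {p l k} → l + k ≤ p → ∀ {xs} → All (λ u → l ≤ u × u < l + k) xs → All (p ≢_) xs
above ≤p = All.map (λ { (_ , u<) → ≢-sym (<⇒≢ (<-≤-trans u< ≤p)) })

ιⁿ-offset : ∀ {p y} l i x → p ≡ l + i → y ≡ l + x → ιⁿ p y ≡ ιⁿ i x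
ιⁿ-offset l i x refl refl = ιⁿ-+ˡ l i x

ιⁿ-+-same : ∀ m n → ιⁿ m (m + n) ≡ ιⁿ 0 n
ιⁿ-+-same m n = ιⁿ-offset m 0 n (sym (+-identityʳ m)) refl

-- An edge {p , q} is traversed by a zigzag iff the distance i of p from the lower end
-- and the distance j of q from the upper end agree up to one; an edge {p , ∞} behaves like
-- the loop at p.
module _ (p d : ℕ) where
  private
    q : ℕ
    q = p + suc d
    P Q : Maybe ℕ → ℕ
    P = ιʷ (pt p)
    Q = ιʷ (pt q)

    edge : ∀ u v {a b c e} → P u ≡ a → P v ≡ b → Q u ≡ c → Q v ≡ e →
      (P u + P v) * (Q u + Q v) ≡ (a + b) * (c + e)
    edge u v refl refl refl refl = refl

    q-offset : ∀ l i → p ≡ l + i → q ≡ l + (i + suc d)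
    q-offset l i eqp = trans (cong (_+ suc d) eqp) (+-assoc l i (suc d))

  pairs-zigU : ∀ l i j m → p ≡ l + i → m ≡ i + d + j →
    pairs P Q (map pt (zigU l (suc (suc m))) ++ ∞ ∷ []) ≡ ιⁿ i j + ιⁿ i (suc j)
  pairs-zigD : ∀ l i j m → p ≡ l + i → m ≡ i + d + j →
    pairs P Q (map pt (zigD l (suc (suc m))) ++ ∞ ∷ []) ≡ ιⁿ i j + ιⁿ (suc i) j
  -- Here `p` is the first vertex, so only the first edge can join it to `q`, namely when `q` is the
  -- upper end, that is, when `j` is 0.
  pairs-zigU l zero j m eqp refl = cong₂ _+_
    (trans (edge (pt l) (pt (suc l + m))
        (ιⁿ-offset l 0 0 eqp (sym (+-identityʳ l)))
        (ιⁿ-offset l 0 (suc m) eqp (sym (+-suc l m)))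
        (ιⁿ-offset l (suc d) 0 (q-offset l 0 eqp) (sym (+-identityʳ l)))
        (trans (ιⁿ-offset l (suc d) (suc m) (q-offset l 0 eqp) (sym (+-suc l m))) (ιⁿ-+-same d j)))
      (*-identityˡ (ιⁿ 0 j)))
    (pairs-zeroˡ P Q (avoid (below (≤-reflexive (cong suc (trans eqp (+-identityʳ l)))) (zigD-bounds (suc l) (suc m)))))
  -- The first edge misses `p`. Dropping the lower end of the interval lowers `i` by one, and the
  -- two summands change places.
  pairs-zigU l (suc i) j m eqp refl = trans (cong₂ _+_
    (edge (pt l) (pt (suc l + m)) {c = Q (pt l)} {Q (pt (suc l + m))}
        (ιⁿ-offset l (suc i) 0 eqp (sym (+-identityʳ l)))
        (trans (ιⁿ-offset l (suc i) (suc m) eqp (sym (+-suc l m)))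
          (ιⁿ-≢ (<⇒≢ (s≤s (≤-trans (m≤m+n i d) (m≤m+n (i + d) j))))))
        refl refl)
    (pairs-zigD (suc l) i j (i + d + j) (trans eqp (+-suc l i)) refl)) (+-comm (ιⁿ i j) _)
  -- Now `q` is the first vertex and all later numbers lie below it, so the roles of `P` and `Q` are
  -- exchanged.
  pairs-zigD l i zero m eqp refl = cong₂ _+_
    (trans (edge (pt (l + suc m)) (pt l)
        (trans (ιⁿ-offset l i (suc m) eqp refl)
          (ιⁿ-≢ (<⇒≢ (s≤s (≤-trans (m≤m+n i d) (m≤m+n (i + d) 0))))))
        (ιⁿ-offset l i 0 eqp (sym (+-identityʳ l)))
        (trans (ιⁿ-offset l (i + suc d) (suc m) (q-offset l i eqp) refl)
          (trans (cong (λ z → ιⁿ z (suc m)) top) (ιⁿ-refl m)))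
        (trans (ιⁿ-offset l (i + suc d) 0 (q-offset l i eqp) (sym (+-identityʳ l)))
          (cong (λ z → ιⁿ z 0) top)))
      (*-identityʳ (ιⁿ i 0)))
    (trans (pairs-comm P Q (map pt (zigU l (suc m)) ++ ∞ ∷ []))
      (pairs-zeroˡ Q P (avoid (above (≤-reflexive (sym (trans (q-offset l i eqp) (cong (l +_) top)))) (zigU-bounds l (suc m))))))
    where
    top : i + suc d ≡ suc (i + d + 0)
    top = trans (+-suc i d) (cong suc (sym (+-identityʳ (i + d))))
  pairs-zigD l i (suc j) m eqp eqm with trans eqm (+-suc (i + d) j)
  ... | refl = trans (cong₂ _+_
    (trans (edge (pt (l + suc m)) (pt l) {P (pt (l + suc m))} {P (pt l)}
        refl refl
        (trans (ιⁿ-offset l (i + suc d) (suc m) (q-offset l i eqp) refl)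
          (trans (cong (λ z → ιⁿ z (suc m)) (+-suc i d)) (ιⁿ-≢ (<⇒≢ (s≤s (m≤m+n (i + d) j))))))
        (trans (ιⁿ-offset l (i + suc d) 0 (q-offset l i eqp) (sym (+-identityʳ l)))
          (cong (λ z → ιⁿ z 0) (+-suc i d))))
      (*-zeroʳ (P (pt (l + suc m)) + P (pt l))))
    (pairs-zigU l i j (i + d + j) eqp refl)) (+-comm (ιⁿ i j) _)

module _ (p : ℕ) where
  private
    P Q : Maybe ℕ → ℕ
    P = ιʷ (pt p)
    Q = ιʷ ∞

  -- A zigzag closes in on the middle of its interval before it moves to `∞`. Its last number
  -- therefore has distances `i` and `j` from the two ends that are equal or differ by one, on a
  -- side fixed by the end at which the zigzag starts.
  pairs-zigU-∞ : ∀ l i j m → p ≡ l + i → m ≡ i + j →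
    pairs P Q (map pt (zigU l (suc m)) ++ ∞ ∷ []) ≡ ιⁿ i j + ιⁿ i (suc j)
  pairs-zigD-∞ : ∀ l i j m → p ≡ l + i → m ≡ i + j →
    pairs P Q (map pt (zigD l (suc m)) ++ ∞ ∷ []) ≡ ιⁿ i j + ιⁿ (suc i) j
  pairs-zigU-∞ l zero zero m eqp refl =
    cong (λ z → (z + 0) * 1 + 0) (ιⁿ-offset l 0 0 eqp (sym (+-identityʳ l)))
  pairs-zigU-∞ l zero (suc j) m eqp refl = cong₂ _+_
    (*-zeroʳ (P (pt l) + P (pt (suc l + j))))
    (pairs-zeroˡ P Q (avoid (below (≤-reflexive (cong suc (trans eqp (+-identityʳ l)))) (zigD-bounds (suc l) (suc j)))))
  pairs-zigU-∞ l (suc i) j m eqp refl = trans (cong₂ _+_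
    (*-zeroʳ (P (pt l) + P (pt (suc l + (i + j)))))
    (pairs-zigD-∞ (suc l) i j (i + j) (trans eqp (+-suc l i)) refl)) (+-comm (ιⁿ i j) _)
  pairs-zigD-∞ l zero zero m eqp refl =
    cong (λ z → (z + 0) * 1 + 0) (ιⁿ-offset l 0 0 eqp refl)
  pairs-zigD-∞ l (suc i) zero m eqp refl = cong₂ _+_
    (*-zeroʳ (P (pt (l + suc (i + 0))) + P (pt l)))
    (pairs-zeroˡ P Q (avoid (above (≤-reflexive (sym (trans eqp (cong (λ z → l + suc z) (sym (+-identityʳ i)))))) (zigU-bounds l (suc (i + 0))))))
  pairs-zigD-∞ l i (suc j) m eqp eqm with trans eqm (+-suc i j)
  ... | refl = trans (cong₂ _+_
    (*-zeroʳ (P (pt (l + suc (i + j))) + P (pt l)))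
    (pairs-zigU-∞ l i j (i + j) eqp refl)) (+-comm (ιⁿ i j) _)

-- The points of `W` and the cycles F_s.

∑ιⁿ-range : ∀ {p} l k → l ≤ p → p < l + k → ∑ (ιⁿ p) (range l k) ≡ 1
∑ιⁿ-range {p} l zero    l≤p p< = ⊥-elim (<-irrefl refl (<-≤-trans p< (≤-trans (≤-reflexive (+-identityʳ l)) l≤p)))
∑ιⁿ-range {p} l (suc k) l≤p p< with l ≟ p
... | yes refl = cong₂ _+_ (ιⁿ-refl l) (∑ιⁿ-∉ (below ≤-refl (range-bounds (suc l) k)))
... | no l≢p   = cong₂ _+_ (ιⁿ-≢ (l≢p ∘ sym))
  (∑ιⁿ-range (suc l) k (≤∧≢⇒< l≤p l≢p) (subst (p <_) (+-suc l k) p<))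

points : ℕ → List (Maybe ℕ)
points n = ∞ ∷ map pt (range 0 n)

IsPoint : ℕ → Maybe ℕ → Set
IsPoint n ∞      = ⊤
IsPoint n (pt p) = p < n

points-unique : ∀ n → Unique (points n)
points-unique n = Allₚ.map⁺ (All.universal (λ _ ()) (range 0 n)) ∷
  Uniqueₚ.map⁺ Maybeₚ.just-injective (range-unique 0 n)

points-valid : ∀ n → All (IsPoint n) (points n)
points-valid n = tt ∷ Allₚ.map⁺ (All.map proj₂ (range-bounds 0 n))

∑ιʷ-points : ∀ n {w} → IsPoint n w → ∑ (ιʷ w) (points n) ≡ 1
∑ιʷ-points n {∞}    _   = cong suc (trans (∑-map (ιʷ ∞) pt (range 0 n)) (∑-zero (All.universal (λ _ → refl) (range 0 n))))
∑ιʷ-points n {pt p} p<n = trans (∑-map (ιʷ (pt p)) pt (range 0 n)) (∑ιⁿ-range 0 n z≤n p<n)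

-- With n = suc s + r, the closed walk pt 0 ∷ loop s r is the Hamilton cycle F_s on the n + 1
-- points whose edges {u , v} are those with u + v ∈ {s , s + 1} mod n, where loops stand for
-- edges at ∞.
loop : ℕ → ℕ → List (Maybe ℕ)
loop s r = map pt (zigD 1 s) ++ ∞ ∷ reverse (map pt (zigU (suc s) r)) ++ pt 0 ∷ []

map-pt↭ : ∀ {xs ys : List ℕ} → xs ↭ ys → map pt xs ↭ map pt ys
map-pt↭ = ↭ₚ.map⁺ pt

loop↭points : ∀ s r → loop s r ↭ points (suc s + r)
loop↭points s r = begin
  loop s r                                                           ↭⟨ ↭ₚ.shift ∞ (map pt (zigD 1 s)) _ ⟩
  ∞ ∷ map pt (zigD 1 s) ++ reverse (map pt (zigU (suc s) r)) ++ pt 0 ∷ []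
    ≡⟨ cong (∞ ∷_) (Listₚ.++-assoc (map pt (zigD 1 s)) _ _) ⟨
  ∞ ∷ (map pt (zigD 1 s) ++ reverse (map pt (zigU (suc s) r))) ++ pt 0 ∷ []
    ↭⟨ prep ∞ (↭ₚ.∷↭∷ʳ (pt 0) _) ⟨
  ∞ ∷ pt 0 ∷ map pt (zigD 1 s) ++ reverse (map pt (zigU (suc s) r))
    ↭⟨ prep ∞ (prep (pt 0) (↭ₚ.++⁺ (map-pt↭ (zigD↭range 1 s)) (↭-trans (↭ₚ.↭-reverse _) (map-pt↭ (zigU↭range (suc s) r))))) ⟩
  ∞ ∷ pt 0 ∷ map pt (range 1 s) ++ map pt (range (suc s) r)
    ≡⟨ cong (λ zs → ∞ ∷ pt 0 ∷ zs) (trans (sym (Listₚ.map-++ pt (range 1 s) _)) (cong (map pt) (sym (range-++ 1 s r)))) ⟩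
  points (suc s + r) ∎
  where open PermutationReasoning

-- The walk has `pt 0` at both ends and every other point once inside, so each point lies on two of
-- its edges.
closed-degree : ∀ n s r → suc s + r ≡ n → ∀ {w} → IsPoint n w →
  wsum (λ u v → ιʷ w u + ιʷ w v) (pt 0 ∷ loop s r) ≡ 2
closed-degree n s r refl {w} w∈ = begin
  wsum _ (pt 0 ∷ loop s r)              ≡⟨ cong (λ ws → wsum (λ u v → f u + f v) (pt 0 ∷ ws)) (Listₚ.++-assoc (map pt (zigD 1 s)) _ (pt 0 ∷ [])) ⟨
  wsum _ (pt 0 ∷ inner ∷ʳ pt 0)         ≡⟨ wsum-degrees f (pt 0) inner (pt 0) ⟩
  f (pt 0) + f (pt 0) + 2 * ∑ f inner   ≡⟨ regroup (f (pt 0)) (∑ f inner) ⟩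
  2 * ∑ f (pt 0 ∷ inner)                ≡⟨ cong (2 *_) (∑-↭ f (↭ₚ.∷↭∷ʳ (pt 0) inner)) ⟩
  2 * ∑ f (inner ∷ʳ pt 0)               ≡⟨ cong (λ ws → 2 * ∑ f ws) (Listₚ.++-assoc (map pt (zigD 1 s)) _ (pt 0 ∷ [])) ⟩
  2 * ∑ f (loop s r)                    ≡⟨ cong (2 *_) (trans (∑-↭ f (loop↭points s r)) (∑ιʷ-points (suc s + r) w∈)) ⟩
  2                                     ∎
  where
  open ≡-Reasoning
  f : Maybe ℕ → ℕ
  f = ιʷ w
  inner : List (Maybe ℕ)
  inner = map pt (zigD 1 s) ++ ∞ ∷ reverse (map pt (zigU (suc s) r))
  regroup : ∀ a b → a + a + 2 * b ≡ 2 * (a + b)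
  regroup = solve-∀

-- Every edge on `W` is used twice by the cycles.

total : (ℕ → ℕ → ℕ) → ℕ → ℕ → ℕ
total h s zero    = 0
-- The first argument of `h` rises while the second falls, so `suc s + r` is the same for all terms
-- `h s r`: they belong to one point set.
total h s (suc k) = h s k + total h (suc s) k

total-zero : ∀ {h} s k → (∀ {s′} r → s ≤ s′ → h s′ r ≡ 0) → total h s k ≡ 0
total-zero s zero    eq = refl
total-zero s (suc k) eq = cong₂ _+_ (eq k ≤-refl) (total-zero (suc s) k (λ r s≤ → eq r (<⇒≤ s≤)))

module _ (P Q : Maybe ℕ → ℕ) where

  -- F_s is cut at `∞` and at the edge that closes it at `pt 0`. What remains is a zigzag on [0 , s]
  -- and one on [s + 1 , n), both run towards `∞`; `join` is the closing edge, which comes from `∞`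
  -- itself when the upper interval is empty.
  lower upper join : ℕ → ℕ → ℕ
  lower s r = pairs P Q (map pt (zigU 0 (suc s)) ++ ∞ ∷ [])
  upper s r = pairs P Q (map pt (zigU (suc s) r) ++ ∞ ∷ [])
  join s zero    = (P (pt 0) + P ∞) * (Q (pt 0) + Q ∞)
  join s (suc r) = (P (pt 0) + P (pt (suc s))) * (Q (pt 0) + Q (pt (suc s)))

  pairs-loop : ∀ s r → pairs P Q (pt 0 ∷ loop s r) ≡ lower s r + (join s r + upper s r)
  pairs-loop s r = begin
    pairs P Q (pt 0 ∷ loop s r)
      ≡⟨ wsum-++ _ (pt 0 ∷ map pt (zigD 1 s)) ∞ _ ⟩
    lower s r + pairs P Q (∞ ∷ reverse Z ++ pt 0 ∷ [])
      ≡⟨ cong (λ ws → lower s r + pairs P Q ws) reversed ⟨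
    lower s r + pairs P Q (reverse (pt 0 ∷ Z ++ ∞ ∷ []))
      ≡⟨ cong (lower s r +_) (trans (pairs-reverse P Q (pt 0 ∷ Z ++ ∞ ∷ [])) (split r)) ⟩
    lower s r + (join s r + upper s r) ∎
    where
    open ≡-Reasoning
    Z : List (Maybe ℕ)
    Z = map pt (zigU (suc s) r)
    reversed : reverse (pt 0 ∷ Z ++ ∞ ∷ []) ≡ ∞ ∷ reverse Z ++ pt 0 ∷ []
    reversed = trans (Listₚ.unfold-reverse (pt 0) (Z ++ ∞ ∷ []))
      (cong (_∷ʳ pt 0) (Listₚ.reverse-++ Z (∞ ∷ [])))
    split : ∀ r → pairs P Q (pt 0 ∷ map pt (zigU (suc s) r) ++ ∞ ∷ []) ≡ join s r + upper s r
    split zero    = refl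
    split (suc r) = refl

  total-loop : ∀ s k → total (λ s r → pairs P Q (pt 0 ∷ loop s r)) s k ≡
    ∑ (λ s → lower s 0) (range s k) + (total join s k + total upper s k)
  total-loop s zero    = refl
  total-loop s (suc k) = trans (cong₂ _+_ (pairs-loop s k) (total-loop (suc s) k))
    (regroup (lower s k) (join s k) (upper s k) (∑ (λ s → lower s 0) (range (suc s) k)) (total join (suc s) k) (total upper (suc s) k))
    where
    regroup : ∀ a b c x y z → a + (b + c) + (x + (y + z)) ≡ a + x + (b + y + (c + z))
    regroup = solve-∀

  -- The pair is {p , p + d} with `j` numbers above its larger member, or {p , ∞} with `d` equal to
  -- 0 and `j` numbers above `p`. The hypotheses express the contribution of each zigzag by
  -- distances from the ends of its interval.
  module _ (p d j : ℕ)
    (lower-zero : ∀ {s} → s < p + d → lower s 0 ≡ 0)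
    (lower-val  : ∀ t → lower (p + d + t) 0 ≡ ιⁿ p t + ιⁿ p (suc t))
    (upper-zero : ∀ {s} r → p ≤ s → upper s r ≡ 0)
    (upper-val  : ∀ s i → p ≡ suc s + i → upper s (i + (d + suc j)) ≡ ιⁿ i j + ιⁿ i (suc j))
    (join-val   : total join 0 (p + d + suc j) ≡ ιⁿ p 0)
    where

    private
      lower-sum : ∀ t k → ∑ (λ s → lower s 0) (range (p + d + t) k) ≡ ∑ (ιⁿ p) (range t k) + ∑ (ιⁿ p) (range (suc t) k)
      lower-sum t zero    = refl
      lower-sum t (suc k) = trans
        (cong₂ _+_ (lower-val t) (trans (cong (λ z → ∑ (λ s → lower s 0) (range z k)) (sym (+-suc (p + d) t))) (lower-sum (suc t) k)))
        (regroup (ιⁿ p t) (ιⁿ p (suc t)) _ _)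
        where
        regroup : ∀ a b c e → a + b + (c + e) ≡ a + c + (b + e)
        regroup = solve-∀

      lower-total : ∑ (λ s → lower s 0) (range 0 (p + d + suc j)) ≡ ∑ (ιⁿ p) (range 0 (suc j)) + ∑ (ιⁿ p) (range 1 (suc j))
      lower-total = begin
        ∑ f (range 0 (p + d + suc j))                           ≡⟨ cong (∑ f) (range-++ 0 (p + d) (suc j)) ⟩
        ∑ f (range 0 (p + d) ++ range (p + d) (suc j))          ≡⟨ ∑-++ f (range 0 (p + d)) _ ⟩
        ∑ f (range 0 (p + d)) + ∑ f (range (p + d) (suc j))
          ≡⟨ cong₂ _+_ (∑-zero (All.map (λ { (_ , s<) → lower-zero s< }) (range-bounds 0 (p + d))))
                       (cong (λ z → ∑ f (range z (suc j))) (sym (+-identityʳ (p + d)))) ⟩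
        ∑ f (range (p + d + 0) (suc j))                         ≡⟨ lower-sum 0 (suc j) ⟩
        ∑ (ιⁿ p) (range 0 (suc j)) + ∑ (ιⁿ p) (range 1 (suc j)) ∎
        where
        open ≡-Reasoning
        f : ℕ → ℕ
        f s = lower s 0

      upper-sum : ∀ s i → p ≡ s + i → total upper s (i + (d + suc j)) ≡ ∑ (ιⁿ j) (range 0 i) + ∑ (ιⁿ (suc j)) (range 0 i)
      upper-sum s zero    eqp = total-zero s (d + suc j) (λ r s≤ → upper-zero r (≤-trans (≤-reflexive (trans eqp (+-identityʳ s))) s≤))
      upper-sum s (suc i) eqp = begin
        upper s (i + (d + suc j)) + total upper (suc s) (i + (d + suc j))
          ≡⟨ cong₂ _+_ (upper-val s i (trans eqp (+-suc s i))) (upper-sum (suc s) i (trans eqp (+-suc s i))) ⟩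
        ιⁿ i j + ιⁿ i (suc j) + (∑ (ιⁿ j) (range 0 i) + ∑ (ιⁿ (suc j)) (range 0 i))
          ≡⟨ regroup (ιⁿ i j) (ιⁿ i (suc j)) (∑ (ιⁿ j) (range 0 i)) (∑ (ιⁿ (suc j)) (range 0 i)) ⟩
        ∑ (ιⁿ j) (range 0 i) + ιⁿ i j + (∑ (ιⁿ (suc j)) (range 0 i) + ιⁿ i (suc j))
          ≡⟨ cong₂ _+_ (snoc j) (snoc (suc j)) ⟩
        ∑ (ιⁿ j) (range 0 (suc i)) + ∑ (ιⁿ (suc j)) (range 0 (suc i)) ∎
        where
        open ≡-Reasoning
        regroup : ∀ a b c e → a + b + (c + e) ≡ c + a + (e + b)
        regroup = solve-∀
        snoc : ∀ j → ∑ (ιⁿ j) (range 0 i) + ιⁿ i j ≡ ∑ (ιⁿ j) (range 0 (suc i))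
        snoc j = begin
          ∑ (ιⁿ j) (range 0 i) + ιⁿ i j        ≡⟨ cong (∑ (ιⁿ j) (range 0 i) +_) (trans (ιⁿ-sym i j) (sym (+-identityʳ _))) ⟩
          ∑ (ιⁿ j) (range 0 i) + (ιⁿ j i + 0)  ≡⟨ ∑-++ (ιⁿ j) (range 0 i) (i ∷ []) ⟨
          ∑ (ιⁿ j) (range 0 i ∷ʳ i)            ≡⟨ cong (∑ (ιⁿ j)) (range-∷ʳ 0 i) ⟩
          ∑ (ιⁿ j) (range 0 (suc i))           ∎

      -- The first sum is 1 exactly when `p ≤ j`, the second exactly when `j < p`.
      dichotomy : ∀ j → ∑ (ιⁿ p) (range 0 (suc j)) + ∑ (ιⁿ j) (range 0 p) ≡ 1
      dichotomy j with p ≤? j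
      ... | yes p≤j = cong₂ _+_ (∑ιⁿ-range 0 (suc j) z≤n (s≤s p≤j)) (∑ιⁿ-∉ (above p≤j (range-bounds 0 p)))
      ... | no  p≰j = cong₂ _+_ (∑ιⁿ-∉ (above (≰⇒> p≰j) (range-bounds 0 (suc j)))) (∑ιⁿ-range 0 p z≤n (≰⇒> p≰j))

    total-pairs : total (λ s r → pairs P Q (pt 0 ∷ loop s r)) 0 (p + (d + suc j)) ≡ 2
    total-pairs = begin
      total (λ s r → pairs P Q (pt 0 ∷ loop s r)) 0 n       ≡⟨ total-loop 0 n ⟩
      ∑ (λ s → lower s 0) (range 0 n) + (total join 0 n + total upper 0 n)
        ≡⟨ cong₂ _+_ (trans (cong (λ z → ∑ (λ s → lower s 0) (range 0 z)) (sym (+-assoc p d (suc j)))) lower-total)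
             (cong₂ _+_ (trans (cong (total join 0) (sym (+-assoc p d (suc j)))) join-val) (upper-sum 0 p refl)) ⟩
      a + b + (ιⁿ p 0 + (c + e′))                           ≡⟨ regroup a b (ιⁿ p 0) c e′ ⟩
      -- The closing edges supply the value 0 missing from the range in `b`, so `dichotomy` applies
      -- once with `j` and once with `suc j`.
      a + c + (ιⁿ p 0 + b + e′)                             ≡⟨ cong₂ _+_ (dichotomy j) (dichotomy (suc j)) ⟩
      2                                                     ∎
      where
      open ≡-Reasoning
      n = p + (d + suc j)
      a = ∑ (ιⁿ p) (range 0 (suc j))
      b = ∑ (ιⁿ p) (range 1 (suc j))
      c = ∑ (ιⁿ j) (range 0 p)
      e′ = ∑ (ιⁿ (suc j)) (range 0 p)
      regroup : ∀ a b x c e → a + b + (x + (c + e)) ≡ a + c + (x + b + e)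
      regroup = solve-∀

loops : (P Q : Maybe ℕ → ℕ) → ℕ → ℕ
loops P Q = total (λ s r → pairs P Q (pt 0 ∷ loop s r)) 0

loops-comm : ∀ P Q n → loops P Q n ≡ loops Q P n
loops-comm P Q = go 0
  where
  go : ∀ s k → total (λ s r → pairs P Q (pt 0 ∷ loop s r)) s k ≡ total (λ s r → pairs Q P (pt 0 ∷ loop s r)) s k
  go s zero    = refl
  go s (suc k) = cong₂ _+_ (pairs-comm P Q (pt 0 ∷ loop s k)) (go (suc s) k)

loops-∞ : ∀ p j → loops (ιʷ (pt p)) (ιʷ ∞) (p + suc j) ≡ 2
loops-∞ p j = total-pairs P Q p 0 j
  (λ {s} s<p → pairs-zeroˡ P Q (avoid (above (≤-trans s<p (≤-reflexive (+-identityʳ p))) (zigU-bounds 0 (suc s)))))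
  (λ t → pairs-zigU-∞ p 0 p t _ refl (cong (_+ t) (+-identityʳ p)))
  (λ {s} r p≤s → pairs-zeroˡ P Q (avoid (below (s≤s p≤s) (zigU-bounds (suc s) r))))
  (λ s i eqp → trans (cong (λ k → pairs P Q (map pt (zigU (suc s) k) ++ ∞ ∷ [])) (+-suc i j))
    (pairs-zigU-∞ p (suc s) i j (i + j) eqp refl))
  (trans (cong (total (join P Q) 0) (+-suc (p + 0) j)) (join-total 0 (p + 0 + j)))
  where
  P Q : Maybe ℕ → ℕ
  P = ιʷ (pt p)
  Q = ιʷ ∞
  -- Only the last cycle closes through `∞`, and there the closing edge is {0 , ∞}.
  join-total : ∀ s k → total (join P Q) s (suc k) ≡ ιⁿ p 0
  join-total s zero    = trans (+-identityʳ _) (trans (*-identityʳ _) (+-identityʳ _))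
  join-total s (suc k) = cong₂ _+_ (*-zeroʳ (P (pt 0) + P (pt (suc s)))) (join-total (suc s) k)

loops-pt : ∀ p d j → loops (ιʷ (pt p)) (ιʷ (pt (p + suc d))) (p + (suc d + suc j)) ≡ 2
loops-pt p d j = total-pairs P Q p (suc d) j
  (λ {s} s<q → trans (pairs-comm P Q (map pt (zigU 0 (suc s)) ++ ∞ ∷ []))
    (pairs-zeroˡ Q P (avoid (above s<q (zigU-bounds 0 (suc s))))))
  (λ t → trans (cong (λ k → pairs P Q (map pt (zigU 0 (suc k)) ++ ∞ ∷ [])) (cong (_+ t) (+-suc p d)))
    (pairs-zigU p d 0 p t (p + d + t) refl refl))
  (λ {s} r p≤s → pairs-zeroˡ P Q (avoid (below (s≤s p≤s) (zigU-bounds (suc s) r))))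
  (λ s i eqp → trans (cong (λ k → pairs P Q (map pt (zigU (suc s) k) ++ ∞ ∷ [])) (index i))
    (pairs-zigU p d (suc s) i j (i + d + j) eqp refl))
  (begin
    total (join P Q) 0 (q + suc j)       ≡⟨ cong (total (join P Q) 0) (+-suc q j) ⟩
    total (join P Q) 0 (suc (q + j))     ≡⟨ join-total 0 (q + j) ⟩
    ιⁿ p 0 * ∑ (ιⁿ q) (range 1 (q + j))  ≡⟨ cong (ιⁿ p 0 *_) (∑ιⁿ-range 1 (q + j) 1≤q (s≤s (m≤m+n q j))) ⟩
    ιⁿ p 0 * 1                           ≡⟨ *-identityʳ _ ⟩
    ιⁿ p 0                               ∎)
  where
  open ≡-Reasoning
  q : ℕ
  q = p + suc d
  P Q : Maybe ℕ → ℕ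
  P = ιʷ (pt p)
  Q = ιʷ (pt q)
  1≤q : 1 ≤ q
  1≤q = ≤-trans (s≤s z≤n) (≤-reflexive (sym (+-suc p d)))
  q≢0 : ιⁿ q 0 ≡ 0
  q≢0 = ιⁿ-≢ (≢-sym (<⇒≢ 1≤q))
  index : ∀ i → i + (suc d + suc j) ≡ suc (suc (i + d + j))
  index i = trans (+-suc i (d + suc j)) (cong suc (trans (cong (i +_) (+-suc d j)) (trans (+-suc i (d + j)) (cong suc (sym (+-assoc i d j))))))
  join-edge : ∀ s → (ιⁿ p 0 + ιⁿ p (suc s)) * (ιⁿ q 0 + ιⁿ q (suc s)) ≡ ιⁿ p 0 * ιⁿ q (suc s)
  join-edge s = begin
    (ιⁿ p 0 + ιⁿ p (suc s)) * (ιⁿ q 0 + ιⁿ q (suc s))          ≡⟨ cong (λ z → (ιⁿ p 0 + ιⁿ p (suc s)) * (z + ιⁿ q (suc s))) q≢0 ⟩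
    (ιⁿ p 0 + ιⁿ p (suc s)) * ιⁿ q (suc s)                     ≡⟨ *-distribʳ-+ (ιⁿ q (suc s)) (ιⁿ p 0) _ ⟩
    ιⁿ p 0 * ιⁿ q (suc s) + ιⁿ p (suc s) * ιⁿ q (suc s)
      ≡⟨ cong (ιⁿ p 0 * ιⁿ q (suc s) +_) (ιⁿ-exclusive (<⇒≢ (m<m+n p (s≤s z≤n))) (suc s)) ⟩
    ιⁿ p 0 * ιⁿ q (suc s) + 0                                  ≡⟨ +-identityʳ _ ⟩
    ιⁿ p 0 * ιⁿ q (suc s)                                      ∎
  -- As `q` is positive, a closing edge {0 , s + 1} joins the pair only if `p` is 0 and `q` is s +
  -- 1; the last cycle closes through `∞` and adds nothing.
  join-total : ∀ s k → total (join P Q) s (suc k) ≡ ιⁿ p 0 * ∑ (ιⁿ q) (range (suc s) k)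
  join-total s zero    = begin
    (ιⁿ p 0 + 0) * (ιⁿ q 0 + 0) + 0   ≡⟨ +-identityʳ _ ⟩
    (ιⁿ p 0 + 0) * (ιⁿ q 0 + 0)       ≡⟨ cong₂ _*_ (+-identityʳ (ιⁿ p 0)) (trans (+-identityʳ (ιⁿ q 0)) q≢0) ⟩
    ιⁿ p 0 * 0                        ∎
  join-total s (suc k) = trans (cong₂ _+_ (join-edge s) (join-total (suc s) k))
    (sym (*-distribˡ-+ (ιⁿ p 0) (ιⁿ q (suc s)) _))

loops-< : ∀ n {p q} → p < q → q < n → loops (ιʷ (pt p)) (ιʷ (pt q)) n ≡ 2
loops-< n {p} p<q q<n with m≤n⇒∃[o]m+o≡n p<q | m≤n⇒∃[o]m+o≡n q<n
... | d , refl | j , refl = subst₂ (λ q n → loops (ιʷ (pt p)) (ιʷ (pt q)) n ≡ 2)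
  (+-suc p d) (index p d j) (loops-pt p d j)
  where
  index : ∀ p d j → p + (suc d + suc j) ≡ suc (suc (p + d) + j)
  index = solve-∀

-- By the symmetry of `pairs`, two numbers may be taken in increasing order and `∞` may be put last.
-- Thus the cycles decompose the doubled complete graph on `W`.
loops-twice : ∀ n {w w′} → IsPoint n w → IsPoint n w′ → w ≢ w′ → loops (ιʷ w) (ιʷ w′) n ≡ 2
loops-twice n {∞}    {∞}     w∈ w′∈ w≢w′ = ⊥-elim (w≢w′ refl)
loops-twice n {pt p} {∞}     p<n _  w≢w′ with m≤n⇒∃[o]m+o≡n p<n
... | j , refl = trans (cong (loops (ιʷ (pt p)) (ιʷ ∞)) (sym (+-suc p j))) (loops-∞ p j)
loops-twice n {∞}    {pt p}  _ p<n  w≢w′ =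
  trans (loops-comm (ιʷ ∞) (ιʷ (pt p)) n) (loops-twice n {pt p} {∞} p<n tt (λ ()))
loops-twice n {pt p} {pt q}  p<n q<n w≢w′ with <-cmp p q
... | tri< p<q _ _ = loops-< n p<q q<n
... | tri≈ _ refl _ = ⊥-elim (w≢w′ refl)
... | tri> _ _ q<p = trans (loops-comm (ιʷ (pt p)) (ιʷ (pt q)) n) (loops-< n q<p p<n)

-- Paths of blocks over walks in `W`.

glue : {A : Set} {R : A → A → Set} → ∀ {xs ys a} →
  Linked R xs → last xs ≡ just a → Linked R (a ∷ ys) → Linked R (xs ++ ys)
glue [-]      refl rys = rys
glue (r ∷ rs) eq   rys = r ∷ glue rs eq rys

last-∷ : {A : Set} → ∀ (x : A) ys {b} → last ys ≡ just b → last (x ∷ ys) ≡ just b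
last-∷ x (y ∷ ys) eq = eq

last-++ : {A : Set} → ∀ (xs ys : List A) {b} → last ys ≡ just b → last (xs ++ ys) ≡ just b
last-++ []       ys eq = eq
last-++ (x ∷ xs) ys eq = last-∷ x (xs ++ ys) (last-++ xs ys eq)

unique-resp-↭ : {A : Set} {xs ys : List A} → xs ↭ ys → Unique xs → Unique ys
unique-resp-↭ p = ↭ₛₚ.Unique-resp-↭ (setoid _) (↭⇒↭ₛ p)

-- New points carry unbounded numbers, so that zigzags need no bounds in their types; `IsPointᵛ`
-- selects the actual points.
Point : ℕ → Set
Point v = Fin v ⊎ Maybe ℕ

pattern V i = inj₁ i
pattern W w = inj₂ w

module I v = Incidence (Sumₚ.≡-dec (Finₚ._≟_ {v}) (Maybeₚ.≡-dec _≟_))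

module Blocks {v : ℕ} where
  open I v public

  old : Triple (Fin v) → Triple (Point v)
  old (a , b , c) = V a , V b , V c

  blk : Fin v → List (Maybe ℕ) → List (Triple (Point v))
  blk i []           = []
  blk i (u ∷ [])     = []
  blk i (u ∷ w ∷ ws) = (V i , W u , W w) ∷ blk i (w ∷ ws)

  V≢ : ∀ {i j : Fin v} → i ≢ j → _≢_ {A = Point v} (V i) (V j)
  V≢ i≢j refl = i≢j refl

  W≢ : ∀ {u w : Maybe ℕ} → u ≢ w → _≢_ {A = Point v} (W u) (W w)
  W≢ u≢w refl = u≢w refl

  blk-meet : ∀ i x y z → x ≢ y → x ≢ z → y ≢ z → Meet₂ (V i , W x , W y) (V i , W y , W z)
  blk-meet i x y z x≢y x≢z y≢z = cong₂ _+_
    (cong₂ _+_ (mem-fst d) (mem-out (W x) (V i) (W y) (W z) (λ ()) (W≢ x≢y) (W≢ x≢z))) (mem-snd d)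
    where
    d : Distinct (V i , W y , W z)
    d = (λ ()) , (λ ()) , W≢ y≢z

  -- Consecutive edges share a vertex and all blocks share `i`. Uniqueness excludes backtracking,
  -- where two consecutive blocks would coincide.
  blk-linked : ∀ i {ws} → Unique ws → Linked Meet₂ (blk i ws)
  blk-linked i []                                             = []
  blk-linked i (_ ∷ [])                                       = []
  blk-linked i (_ ∷ _ ∷ [])                                   = [-]
  blk-linked i ((x≢y ∷ x≢z ∷ _) ∷ u@((y≢z ∷ _) ∷ _ ∷ _))      = blk-meet i _ _ _ x≢y x≢z y≢z ∷ blk-linked i u

  blk-distinct : ∀ i {ws} → Linked _≢_ ws → All Distinct (blk i ws)
  blk-distinct i []         = []
  blk-distinct i [-]        = []
  blk-distinct i (u≢w ∷ us) = ((λ ()) , (λ ()) , W≢ u≢w) ∷ blk-distinct i us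

  blk-last : ∀ i ws u w → last (blk i (ws ++ u ∷ w ∷ [])) ≡ just (V i , W u , W w)
  blk-last i []            u w = refl
  blk-last i (x ∷ [])      u w = refl
  blk-last i (x ∷ y ∷ ws)  u w = last-∷ _ (blk i (y ∷ ws ++ u ∷ w ∷ [])) (blk-last i (y ∷ ws) u w)

  ∑-blk : ∀ p q i ws → ∑ (covers p q) (blk i ws) ≡ wsum (λ u w → covers p q (V i , W u , W w)) ws
  ∑-blk p q i []           = refl
  ∑-blk p q i (u ∷ [])     = refl
  ∑-blk p q i (u ∷ w ∷ ws) = cong (covers p q (V i , W u , W w) +_) (∑-blk p q i (w ∷ ws))

  IsPointᵛ : ℕ → Point v → Set
  IsPointᵛ n (V i) = ⊤
  IsPointᵛ n (W w) = IsPoint n w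

  IsBlock : ℕ → Triple (Point v) → Set
  IsBlock n (a , b , c) = IsPointᵛ n a × IsPointᵛ n b × IsPointᵛ n c

  blk-valid : ∀ {n} i {ws} → All (IsPoint n) ws → All (IsBlock n) (blk i ws)
  blk-valid i []             = []
  blk-valid i (_ ∷ [])       = []
  blk-valid i (pu ∷ pw ∷ ps) = (tt , pu , pw) ∷ blk-valid i (pw ∷ ps)

  -- The start `u` of the walk and the label `i` are the two shared points. Naming `w` separately
  -- guarantees a second vertex even when `ws₁` is empty.
  enter-blk : ∀ {x i} → x ≢ i → ∀ u ws₁ w ws₂ {ts} → Unique (u ∷ ws₁ ++ w ∷ ws₂) →
    Linked Meet₂ (blk i (u ∷ ws₁ ++ w ∷ ws₂) ++ ts) →
    Linked Meet₂ ((W u , V x , V i) ∷ blk i (u ∷ ws₁ ++ w ∷ ws₂) ++ ts)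
  enter-blk {x} {i} x≢i u ws₁ w ws₂ uniq linked = go ws₁ uniq linked
    where
    meet : ∀ w → u ≢ w → Meet₂ (W u , V x , V i) (V i , W u , W w)
    meet w u≢w = cong₂ _+_
      (cong₂ _+_ (mem-snd d) (mem-out (V x) (V i) (W u) (W w) (V≢ x≢i) (λ ()) (λ ()))) (mem-fst d)
      where
      d : Distinct (V i , W u , W w)
      d = (λ ()) , (λ ()) , W≢ u≢w
    go : ∀ ws₁ {ts} → Unique (u ∷ ws₁ ++ w ∷ ws₂) → Linked Meet₂ (blk i (u ∷ ws₁ ++ w ∷ ws₂) ++ ts) →
      Linked Meet₂ ((W u , V x , V i) ∷ blk i (u ∷ ws₁ ++ w ∷ ws₂) ++ ts)
    go []        ((u≢w ∷ _) ∷ _) linked = meet w u≢w ∷ linked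
    go (w′ ∷ _)  ((u≢w ∷ _) ∷ _) linked = meet w′ u≢w ∷ linked

  loop-unique : ∀ s r → Unique (loop s r)
  loop-unique s r = unique-resp-↭ (↭-sym (loop↭points s r)) (points-unique (suc s + r))

  loop-valid : ∀ {n} s r → suc s + r ≡ n → All (IsPoint n) (loop s r)
  loop-valid s r refl = ↭ₚ.All-resp-↭ (↭-sym (loop↭points s r)) (points-valid (suc s + r))

  -- A nonempty upper zigzag starts at s + 1, so after reversal this is the vertex before the final
  -- 0. The edge {s + 1 , 0} also lies in F_{s+1}, where the Hamilton cycle goes on.
  blk-loop-last : ∀ i xs s r → last (blk i (xs ++ loop s (suc r))) ≡ just (V i , W (pt (suc s)) , W (pt 0))
  blk-loop-last i xs s r = trans (cong (λ ws → last (blk i ws)) split) (blk-last i (xs ++ map pt (zigD 1 s) ++ ∞ ∷ reverse Z) (pt (suc s)) (pt 0))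
    where
    Z = map pt (zigD (suc (suc s)) r)
    split : xs ++ loop s (suc r) ≡ (xs ++ map pt (zigD 1 s) ++ ∞ ∷ reverse Z) ++ pt (suc s) ∷ pt 0 ∷ []
    split = begin
      xs ++ map pt (zigD 1 s) ++ ∞ ∷ reverse (pt (suc s) ∷ Z) ++ pt 0 ∷ []
        ≡⟨ cong (λ zs → xs ++ map pt (zigD 1 s) ++ ∞ ∷ zs ++ pt 0 ∷ []) (Listₚ.unfold-reverse (pt (suc s)) Z) ⟩
      xs ++ map pt (zigD 1 s) ++ ∞ ∷ (reverse Z ∷ʳ pt (suc s)) ++ pt 0 ∷ []
        ≡⟨ cong (λ zs → xs ++ map pt (zigD 1 s) ++ ∞ ∷ zs) (Listₚ.++-assoc (reverse Z) _ _) ⟩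
      xs ++ map pt (zigD 1 s) ++ (∞ ∷ reverse Z) ++ pt (suc s) ∷ pt 0 ∷ []
        ≡⟨ cong (xs ++_) (Listₚ.++-assoc (map pt (zigD 1 s)) _ _) ⟨
      xs ++ (map pt (zigD 1 s) ++ ∞ ∷ reverse Z) ++ pt (suc s) ∷ pt 0 ∷ []
        ≡⟨ Listₚ.++-assoc xs _ _ ⟨
      (xs ++ map pt (zigD 1 s) ++ ∞ ∷ reverse Z) ++ pt (suc s) ∷ pt 0 ∷ [] ∎
      where open ≡-Reasoning

  -- The blocks from F_{s+2}, F_{s+3}, …, with abc inserted before those of the last cycle.
  chain : ℕ → List (Fin v) → Fin v → List (Triple (Point v))
  chain s []       x = (W (pt 0) , W (pt (2 + s)) , W (pt 1)) ∷ blk x (loop (2 + s) 0)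
  chain s (i ∷ is) x = blk i (pt 0 ∷ loop (2 + s) (suc (length is))) ++ chain (suc s) is x

  chain-linked : ∀ s j is x → Unique (j ∷ is) →
    Linked Meet₂ ((V j , W (pt (2 + s)) , W (pt 0)) ∷ chain s is x)
  -- `abc` bridges the edge ab omitted from the last cycle: it shares a and b with the block before
  -- it, b and c with the one after it.
  chain-linked s j [] x _ =
    cong₂ _+_ (cong₂ _+_ (mem-out (V j) (W (pt 0)) (W (pt (2 + s))) (W (pt 1)) (λ ()) (λ ()) (λ ())) (mem-snd abc)) (mem-fst abc)
    ∷ cong₂ _+_ (cong₂ _+_ (mem-out (W (pt 0)) (V x) (W (pt (2 + s))) (W (pt 1)) (λ ()) (λ ()) (λ ())) (mem-snd xbc)) (mem-thd xbc)
    ∷ blk-linked x (loop-unique (2 + s) 0)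
    where
    abc : Distinct {Point v} (W (pt 0) , W (pt (2 + s)) , W (pt 1))
    abc = (λ ()) , (λ ()) , (λ ())
    xbc : Distinct (V x , W (pt (2 + s)) , W (pt 1))
    xbc = (λ ()) , (λ ()) , (λ ())
  -- Both blocks contain the edge {0 , s + 2}, which F_{s+1} and F_{s+2} have in common.
  chain-linked s j (i ∷ is) x ((j≢i ∷ _) ∷ u) =
    cong₂ _+_ (cong₂ _+_ (mem-out (V j) (V i) (W (pt 0)) (W (pt (2 + s))) (V≢ j≢i) (λ ()) (λ ())) (mem-thd i0b)) (mem-snd i0b)
    ∷ glue (blk-meet i (pt 0) (pt (2 + s)) (pt 1) (λ ()) (λ ()) (λ ()) ∷ blk-linked i (loop-unique (2 + s) (suc (length is))))
           (blk-loop-last i (pt 0 ∷ []) (2 + s) (length is))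
           (chain-linked (suc s) i is x u)
    where
    i0b : Distinct (V i , W (pt 0) , W (pt (2 + s)))
    i0b = (λ ()) , (λ ()) , (λ ())

  chain-last : ∀ s is x → last (chain s is x) ≡ just (V x , W ∞ , W (pt 0))
  chain-last s []       x = last-∷ (W (pt 0) , W (pt (2 + s)) , W (pt 1)) (blk x (loop (2 + s) 0)) (blk-last x (map pt (zigD 1 (2 + s))) ∞ (pt 0))
  chain-last s (i ∷ is) x = last-++ (blk i (pt 0 ∷ loop (2 + s) (suc (length is)))) (chain (suc s) is x) (chain-last (suc s) is x)

  chain-distinct : ∀ s is x → All Distinct (chain s is x)
  chain-distinct s []       x = ((λ ()) , (λ ()) , (λ ())) ∷ blk-distinct x (Linkedₚ.AllPairs⇒Linked (loop-unique (2 + s) 0))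
  chain-distinct s (i ∷ is) x = Allₚ.++⁺
    (blk-distinct i ((λ ()) ∷ Linkedₚ.AllPairs⇒Linked (loop-unique (2 + s) (suc (length is)))))
    (chain-distinct (suc s) is x)

  chain-valid : ∀ {n} s is x → 3 + s + length is ≡ n → All (IsBlock n) (chain s is x)
  chain-valid s []       x refl = (s≤s z≤n , ≤-reflexive (sym (+-identityʳ (3 + s))) , s≤s (s≤s z≤n)) ∷
    blk-valid x (loop-valid (2 + s) 0 refl)
  chain-valid s (i ∷ is) x refl = Allₚ.++⁺
    (blk-valid i (s≤s z≤n ∷ loop-valid (2 + s) (suc (length is)) refl))
    (chain-valid (suc s) is x (sym (+-suc (3 + s) (length is))))

  -- The cycles before the exchange of blocks; each label takes one F_s, and the number of labels
  -- left is the `r` of `loop`.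
  full : ℕ → List (Fin v) → List (Triple (Point v))
  full s []       = []
  full s (i ∷ is) = blk i (pt 0 ∷ loop s (length is)) ++ full (suc s) is

  -- The chain has `abc` in addition and lacks only the block on the edge ab of the last cycle.
  -- Adding the lacking block on the left avoids subtraction.
  chain-count : ∀ p q b s is x → b ≡ 2 + s + length is →
    ∑ (covers p q) (chain s is x) + covers p q (V x , W (pt 0) , W (pt b)) ≡
    covers p q (W (pt 0) , W (pt b) , W (pt 1)) + ∑ (covers p q) (full (2 + s) (is ∷ʳ x))
  chain-count p q b s [] x eq with trans eq (+-identityʳ (2 + s))
  ... | refl = trans (regroup (covers p q (W (pt 0) , W (pt b) , W (pt 1))) (∑ (covers p q) (blk x (loop b 0))) _)
      (cong (λ zs → covers p q (W (pt 0) , W (pt b) , W (pt 1)) + ∑ (covers p q) zs) (sym (Listₚ.++-identityʳ (blk x (pt 0 ∷ loop b 0)))))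
    where
    regroup : ∀ a c e → a + c + e ≡ a + (e + c)
    regroup = solve-∀
  chain-count p q b s (i ∷ is) x eq = begin
    ∑ f (B ++ chain (suc s) is x) + f xab            ≡⟨ cong (_+ f xab) (∑-++ f B (chain (suc s) is x)) ⟩
    ∑ f B + ∑ f (chain (suc s) is x) + f xab         ≡⟨ +-assoc (∑ f B) _ (f xab) ⟩
    ∑ f B + (∑ f (chain (suc s) is x) + f xab)       ≡⟨ cong (∑ f B +_) (chain-count p q b (suc s) is x (trans eq (+-suc (2 + s) (length is)))) ⟩
    ∑ f B + (f abc + ∑ f (full (3 + s) (is ∷ʳ x)))   ≡⟨ regroup (∑ f B) (f abc) _ ⟩
    f abc + (∑ f B + ∑ f (full (3 + s) (is ∷ʳ x)))   ≡⟨ cong (f abc +_) (∑-++ f B (full (3 + s) (is ∷ʳ x))) ⟨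
    f abc + ∑ f (B ++ full (3 + s) (is ∷ʳ x))
      ≡⟨ cong (λ k → f abc + ∑ f (blk i (pt 0 ∷ loop (2 + s) k) ++ full (3 + s) (is ∷ʳ x))) (trans (Listₚ.length-++ is) (+-comm (length is) 1)) ⟨
    f abc + ∑ f (full (2 + s) (i ∷ is ∷ʳ x))         ∎
    where
    open ≡-Reasoning
    f = covers p q
    B = blk i (pt 0 ∷ loop (2 + s) (suc (length is)))
    xab = V x , W (pt 0) , W (pt b)
    abc = W (pt 0) , W (pt b) , W (pt 1)
    regroup : ∀ a b c → a + (b + c) ≡ b + (a + c)
    regroup = solve-∀

  -- A block over a cycle contains only one old point.
  full-VV : ∀ {i j} → i ≢ j → ∀ s is → ∑ (covers (V i) (V j)) (full s is) ≡ 0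
  full-VV {i} {j} i≢j s is = ∑-zero (go s is)
    where
    blocks : ∀ k ws → All (λ t → covers (V i) (V j) t ≡ 0) (blk k ws)
    blocks k []           = []
    blocks k (_ ∷ [])     = []
    blocks k (u ∷ w ∷ ws) = trans (cong₂ _*_ (pad i) (pad j)) (ι-exclusive (V≢ i≢j) (V k)) ∷ blocks k (w ∷ ws)
      where
      pad : ∀ i → ιᶠ i k + 0 + 0 ≡ ιᶠ i k
      pad i = trans (+-identityʳ _) (+-identityʳ _)
    go : ∀ s is → All (λ t → covers (V i) (V j) t ≡ 0) (full s is)
    go s []       = []
    go s (k ∷ is) = Allₚ.++⁺ (blocks k _) (go (suc s) is)

  -- Only cycles labelled `i` count, and in each of them `w` has degree two.
  full-VW : ∀ n {i w} → IsPoint n w → ∀ s is → s + length is ≡ n →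
    ∑ (covers (V i) (W w)) (full s is) ≡ ∑ (ιᶠ i) is * 2
  full-VW n w∈ s [] eq = refl
  full-VW n {i} {w} w∈ s (k ∷ is) eq = begin
    ∑ f (blk k ws ++ full (suc s) is)                    ≡⟨ ∑-++ f (blk k ws) _ ⟩
    ∑ f (blk k ws) + ∑ f (full (suc s) is)               ≡⟨ cong₂ _+_ head (full-VW n w∈ (suc s) is eq′) ⟩
    ιᶠ i k * 2 + ∑ (ιᶠ i) is * 2                         ≡⟨ *-distribʳ-+ 2 (ιᶠ i k) _ ⟨
    (ιᶠ i k + ∑ (ιᶠ i) is) * 2                           ∎
    where
    open ≡-Reasoning
    f = covers (V i) (W w)
    ws = pt 0 ∷ loop s (length is)
    eq′ : suc s + length is ≡ n
    eq′ = trans (sym (+-suc s (length is))) eq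
    scale : ∀ ws → wsum (λ u w′ → f (V k , W u , W w′)) ws ≡ ιᶠ i k * wsum (λ u w′ → ιʷ w u + ιʷ w w′) ws
    scale []             = sym (*-zeroʳ (ιᶠ i k))
    scale (_ ∷ [])       = sym (*-zeroʳ (ιᶠ i k))
    scale (u ∷ w′ ∷ ws)  = trans
      (cong₂ _+_ (cong (_* (ιʷ w u + ιʷ w w′)) (trans (+-identityʳ _) (+-identityʳ (ιᶠ i k)))) (scale (w′ ∷ ws)))
      (sym (*-distribˡ-+ (ιᶠ i k) (ιʷ w u + ιʷ w w′) _))
    head : ∑ f (blk k ws) ≡ ιᶠ i k * 2
    head = trans (∑-blk (V i) (W w) k ws) (trans (scale ws) (cong (ιᶠ i k *_) (closed-degree n s (length is) eq′ w∈)))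

  full-WW : ∀ w w′ s is → ∑ (covers (W w) (W w′)) (full s is) ≡
    total (λ s r → pairs (ιʷ w) (ιʷ w′) (pt 0 ∷ loop s r)) s (length is)
  full-WW w w′ s []       = refl
  full-WW w w′ s (k ∷ is) = trans (∑-++ (covers (W w) (W w′)) (blk k (pt 0 ∷ loop s (length is))) _)
    (cong₂ _+_ (∑-blk (W w) (W w′) k (pt 0 ∷ loop s (length is))) (full-WW w w′ (suc s) is))

  -- Each point lies in two blocks on either side, so this is a semiring identity even though
  -- covers p q also counts the diagonal products ι p u * ι q u.
  trade : ∀ p q x y z a b c →
    covers p q (a , x , y) + covers p q (b , x , z) + covers p q (c , y , z) + covers p q (a , b , c) ≡
    covers p q (x , y , z) + covers p q (x , a , b) + covers p q (y , a , c) + covers p q (z , b , c)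
  trade p q x y z a b c = identity
    (ι p x) (ι p y) (ι p z) (ι p a) (ι p b) (ι p c) (ι q x) (ι q y) (ι q z) (ι q a) (ι q b) (ι q c)
    where
    identity : ∀ x y z a b c x′ y′ z′ a′ b′ c′ →
      (a + x + y) * (a′ + x′ + y′) + (b + x + z) * (b′ + x′ + z′) + (c + y + z) * (c′ + y′ + z′) + (a + b + c) * (a′ + b′ + c′) ≡
      (x + y + z) * (x′ + y′ + z′) + (x + a + b) * (x′ + a′ + b′) + (y + a + c) * (y′ + a′ + c′) + (z + b + c) * (z′ + b′ + c′)
    identity = solve-∀

-- The exchange of blocks and the doubled system.

∑ιᶠ-allFin : ∀ {m} (i : Fin m) → ∑ (ιᶠ i) (allFin m) ≡ 1
∑ιᶠ-allFin {suc m} i = trans (cong (λ js → ιᶠ i zero + ∑ (ιᶠ i) js) (sym (Listₚ.map-tabulate id suc)))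
  (trans (cong (ιᶠ i zero +_) (∑-map (ιᶠ i) suc (allFin m))) (split i))
  where
  split : ∀ i → ιᶠ i zero + ∑ (ιᶠ i ∘ suc) (allFin m) ≡ 1
  split zero    = cong suc (∑-zero (All.universal (λ _ → refl) (allFin m)))
  split (suc i) = ∑ιᶠ-allFin i

-- The old Hamilton cycle opened at the block xyz: `olds` is the remaining path, whose end blocks
-- contain the pairs xy and xz.
record Arrangement (v : ℕ) : Set where
  field
    x y z         : Fin v
    B₁ Bₖ         : Triple (Fin v)
    mid           : List (Triple (Fin v))
  olds : List (Triple (Fin v))
  olds = B₁ ∷ mid ∷ʳ Bₖ
  field
    xyz-distinct  : Distinct (x , y , z)
    x∈B₁          : memᶠ x B₁ ≡ 1
    y∈B₁          : memᶠ y B₁ ≡ 1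
    x∈Bₖ          : memᶠ x Bₖ ≡ 1
    z∈Bₖ          : memᶠ z Bₖ ≡ 1
    olds-distinct : All Distinct olds
    olds-linked   : Linked Meet₂ᶠ olds
    olds-balanced : ∀ {p q} → p ≢ q → ∑ (coversᶠ p q) ((x , y , z) ∷ olds) ≡ 2

-- `z` labels F_0, `y` labels F_1 and `x` the last cycle, because these contain the edges bc, ac and
-- ab for a = 0, b = v - 1, c = 1.
record Labelling {v : ℕ} (x y z : Fin v) : Set where
  field
    inner : List (Fin v)
    perm  : z ∷ y ∷ inner ∷ʳ x ↭ allFin v

module Doubling {v : ℕ} (A : Arrangement v) (Λ : Labelling (Arrangement.x A) (Arrangement.y A) (Arrangement.z A)) where
  open Arrangement A
  open Labelling Λ
  open Blocks {v}

  private
    k n : ℕ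
    k = length inner
    n = 3 + k

    a b c : Point v
    a = W (pt 0)
    b = W (pt (2 + k))
    c = W (pt 1)

    axy bxz cyz : Triple (Point v)
    axy = a , V x , V y
    bxz = b , V x , V z
    cyz = c , V y , V z

    labels : List (Fin v)
    labels = z ∷ y ∷ inner ∷ʳ x

    labels-length : length labels ≡ n
    labels-length = cong (2 +_) (trans (Listₚ.length-++ inner {x ∷ []}) (+-comm k 1))

    n≡v : n ≡ v
    n≡v = trans (sym labels-length) (trans (↭ₚ.↭-length perm) (Listₚ.length-tabulate id))

    labels-once : ∀ i → ∑ (ιᶠ i) labels ≡ 1
    labels-once i = trans (∑-↭ (ιᶠ i) perm) (∑ιᶠ-allFin i)

    y∷inner-unique : Unique (y ∷ inner)
    y∷inner-unique 
      with unique-resp-↭ (↭-trans (↭-sym perm) (↭-sym (↭ₚ.∷↭∷ʳ x (z ∷ y ∷ inner)))) (Uniqueₚ.allFin⁺ v)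
    ... | _ ∷ _ ∷ u = u

    x≢y : x ≢ y
    x≢y = proj₁ xyz-distinct
    x≢z : x ≢ z
    x≢z = proj₁ (proj₂ xyz-distinct)
    y≢z : y ≢ z
    y≢z = proj₂ (proj₂ xyz-distinct)

    -- F_0 without the edge bc, traversed from b to c.
    walk₀ : List (Maybe ℕ)
    walk₀ = map pt (zigD 2 (suc k)) ++ ∞ ∷ pt 0 ∷ pt 1 ∷ []

    walk₀↭points : walk₀ ↭ points n
    walk₀↭points = ↭-trans (↭ₚ.++-comm (map pt (zigD 2 (suc k))) (∞ ∷ pt 0 ∷ pt 1 ∷ []))
      (prep ∞ (prep (pt 0) (prep (pt 1) (map-pt↭ (zigD↭range 2 (suc k))))))

    walk₀-unique : Unique walk₀
    walk₀-unique = unique-resp-↭ (↭-sym walk₀↭points) (points-unique n)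

    new : List (Triple (Point v))
    new = bxz ∷ blk z walk₀ ++ cyz ∷ blk y (loop 1 (suc k)) ++ chain 0 inner x

    blocks : List (Triple (Point v))
    blocks = axy ∷ map old olds ++ new

    axy-distinct : Distinct axy
    axy-distinct = (λ ()) , (λ ()) , V≢ x≢y
    bxz-distinct : Distinct bxz
    bxz-distinct = (λ ()) , (λ ()) , V≢ x≢z
    cyz-distinct : Distinct cyz
    cyz-distinct = (λ ()) , (λ ()) , V≢ y≢z

    blocks-distinct : All Distinct blocks
    blocks-distinct = axy-distinct ∷ Allₚ.++⁺
      (Allₚ.map⁺ (All.map (λ { (d , e , f) → V≢ d , V≢ e , V≢ f }) olds-distinct))
      (bxz-distinct ∷ Allₚ.++⁺ (blk-distinct z (Linkedₚ.AllPairs⇒Linked walk₀-unique))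
        (cyz-distinct ∷ Allₚ.++⁺ (blk-distinct y (Linkedₚ.AllPairs⇒Linked (loop-unique 1 (suc k))))
          (chain-distinct 0 inner x)))

    blocks-valid : All (IsBlock n) blocks
    blocks-valid = (s≤s z≤n , tt , tt) ∷ Allₚ.++⁺
      (Allₚ.map⁺ (All.universal (λ _ → tt , tt , tt) olds))
      ((≤-refl , tt , tt) ∷ Allₚ.++⁺ (blk-valid z (↭ₚ.All-resp-↭ (↭-sym walk₀↭points) (points-valid n)))
        ((s≤s (s≤s z≤n) , tt , tt) ∷ Allₚ.++⁺ (blk-valid y (loop-valid 1 (suc k) refl))
          (chain-valid 0 inner x refl)))

    new-linked : Linked Meet₂ (old Bₖ ∷ new ++ axy ∷ [])
    new-linked = subst (λ zs → Linked Meet₂ (old Bₖ ∷ bxz ∷ zs)) (sym assoc) linked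
      where
      K₀ = blk z walk₀
      K₁ = blk y (loop 1 (suc k))
      K₂ = chain 0 inner x
      assoc : (K₀ ++ cyz ∷ K₁ ++ K₂) ++ axy ∷ [] ≡ K₀ ++ cyz ∷ K₁ ++ K₂ ++ axy ∷ []
      assoc = trans (Listₚ.++-assoc K₀ _ _) (cong (λ zs → K₀ ++ cyz ∷ zs) (Listₚ.++-assoc K₁ _ _))
      yc : Distinct (V y , c , W ∞)
      yc = (λ ()) , (λ ()) , (λ ())
      end : Linked Meet₂ ((V y , W (pt 2) , a) ∷ K₂ ++ axy ∷ [])
      end = glue (chain-linked 0 y inner x y∷inner-unique)
        (last-∷ _ K₂ (chain-last 0 inner x))
        -- The last block of the chain consists of x, `∞` and a, so it shares x and a with `axy` and
        -- closes the cycle.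
        (cong₂ _+_ (cong₂ _+_ (mem-snd axy-distinct) (mem-out (W ∞) a (V x) (V y) (λ ()) (λ ()) (λ ()))) (mem-fst axy-distinct) ∷ [-])
      from-cyz : Linked Meet₂ (cyz ∷ K₁ ++ K₂ ++ axy ∷ [])
      -- With its first edge ac dropped, F_1 starts at c, and `cyz` shares y and c with its first
      -- block.
      from-cyz = cong₂ _+_ (cong₂ _+_ (mem-snd yc) (mem-fst yc)) (mem-out (V z) (V y) c (W ∞) (V≢ (y≢z ∘ sym)) (λ ()) (λ ()))
        ∷ glue (blk-linked y (loop-unique 1 (suc k))) (blk-loop-last y [] 1 k) end
      from-bxz : Linked Meet₂ (bxz ∷ K₀ ++ cyz ∷ K₁ ++ K₂ ++ axy ∷ [])
      from-bxz = enter-blk x≢z (pt (2 + k)) (map pt (zigU 2 k)) ∞ (pt 0 ∷ pt 1 ∷ []) walk₀-unique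
        (glue (blk-linked z walk₀-unique) K₀-last
          -- F_0 without bc ends with the edge ac, so `cyz` shares z and c with its last block.
          (cong₂ _+_ (cong₂ _+_ (mem-thd cyz-distinct) (mem-out a c (V y) (V z) (λ ()) (λ ()) (λ ()))) (mem-fst cyz-distinct) ∷ from-cyz))
        where
        K₀-last : last K₀ ≡ just (V z , a , c)
        K₀-last = trans (cong (λ ws → last (blk z ws)) (sym (Listₚ.++-assoc (map pt (zigD 2 (suc k))) (∞ ∷ []) _)))
          (blk-last z (map pt (zigD 2 (suc k)) ++ ∞ ∷ []) (pt 0) (pt 1))
      linked : Linked Meet₂ (old Bₖ ∷ bxz ∷ K₀ ++ cyz ∷ K₁ ++ K₂ ++ axy ∷ [])
      linked = trans (common-sym (old Bₖ) bxz) (cong₂ _+_ x∈Bₖ z∈Bₖ) ∷ from-bxz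

    blocks-cyclic : Linked Meet₂ (blocks ∷ʳ axy)
    blocks-cyclic = subst (λ zs → Linked Meet₂ (axy ∷ zs)) (sym (Listₚ.++-assoc (map old olds) new (axy ∷ [])))
      (cong₂ _+_ x∈B₁ y∈B₁ ∷ glue (Linkedₚ.map⁺ olds-linked) olds-last new-linked)
      where
      olds-last : last (map old olds) ≡ just (old Bₖ)
      olds-last = trans (cong last (Listₚ.map-++ old (B₁ ∷ mid) (Bₖ ∷ [])))
        (last-++ (map old (B₁ ∷ mid)) (old Bₖ ∷ []) refl)

    -- With the edge bc put back, the walk closes up to F_0. It is rotated to start at 0 and then
    -- reversed, which changes no edge.
    walk₀-count : ∀ p q → ∑ (covers p q) (blk z walk₀) + covers p q (V z , b , c) ≡
      ∑ (covers p q) (blk z (pt 0 ∷ loop 0 (2 + k)))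
    walk₀-count p q = begin
      ∑ (covers p q) (blk z walk₀) + g (pt (2 + k)) (pt 1)
        ≡⟨ cong₂ _+_ (∑-blk p q z walk₀) (g-sym (pt (2 + k)) (pt 1)) ⟩
      wsum g walk₀ + g (pt 1) (pt (2 + k))
        ≡⟨ cong (_+ g (pt 1) (pt (2 + k))) (trans (cong (wsum g) (sym (Listₚ.++-assoc Y (∞ ∷ []) (pt 0 ∷ pt 1 ∷ [])))) (wsum-++ g (Y ++ ∞ ∷ []) (pt 0) (pt 1 ∷ []))) ⟩
      wsum g ((Y ++ ∞ ∷ []) ∷ʳ pt 0) + (g (pt 0) (pt 1) + 0) + g (pt 1) (pt (2 + k))
        ≡⟨ regroup (wsum g ((Y ++ ∞ ∷ []) ∷ʳ pt 0)) (g (pt 0) (pt 1)) (g (pt 1) (pt (2 + k))) ⟩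
      wsum g (pt 0 ∷ pt 1 ∷ (Y ++ ∞ ∷ []) ∷ʳ pt 0)
        ≡⟨ wsum-reverse g g-sym (pt 0 ∷ pt 1 ∷ (Y ++ ∞ ∷ []) ∷ʳ pt 0) ⟨
      wsum g (reverse (pt 0 ∷ pt 1 ∷ (Y ++ ∞ ∷ []) ∷ʳ pt 0))
        ≡⟨ cong (wsum g) reversed ⟩
      wsum g (pt 0 ∷ loop 0 (2 + k))
        ≡⟨ ∑-blk p q z (pt 0 ∷ loop 0 (2 + k)) ⟨
      ∑ (covers p q) (blk z (pt 0 ∷ loop 0 (2 + k))) ∎
      where
      open ≡-Reasoning
      Y : List (Maybe ℕ)
      Y = map pt (zigD 2 (suc k))
      g : Maybe ℕ → Maybe ℕ → ℕ
      g u w = covers p q (V z , W u , W w)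
      g-sym : ∀ u w → g u w ≡ g w u
      g-sym u w = cong₂ _*_ (mem-swap p) (mem-swap q)
        where
        mem-swap : ∀ p → mem p (V z , W u , W w) ≡ mem p (V z , W w , W u)
        mem-swap p = swap₂₃ (ι p (V z)) (ι p (W u)) (ι p (W w))
          where
          swap₂₃ : ∀ l m n → l + m + n ≡ l + n + m
          swap₂₃ = solve-∀
      regroup : ∀ s e f → s + (e + 0) + f ≡ e + (f + s)
      regroup = solve-∀
      reversed : reverse (pt 0 ∷ pt 1 ∷ (Y ++ ∞ ∷ []) ∷ʳ pt 0) ≡ pt 0 ∷ ∞ ∷ reverse (pt 1 ∷ Y) ++ pt 0 ∷ []
      reversed = trans (Listₚ.unfold-reverse (pt 0) ((pt 1 ∷ Y ++ ∞ ∷ []) ∷ʳ pt 0))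
        (cong (_∷ʳ pt 0) (trans (Listₚ.reverse-++ (pt 1 ∷ Y ++ ∞ ∷ []) (pt 0 ∷ []))
          (cong (pt 0 ∷_) (Listₚ.reverse-++ (pt 1 ∷ Y) (∞ ∷ [])))))

    -- The blocks xab, yac and zbc are added on both sides and cancelled at the end: on the left
    -- they complete the three opened cycles, and `trade` then turns the four exchanged blocks into
    -- xyz and these three.
    ∑-blocks : ∀ p q → ∑ (covers p q) blocks ≡
      ∑ (covers p q) (map old ((x , y , z) ∷ olds)) + ∑ (covers p q) (full 0 labels)
    ∑-blocks p q = +-cancelʳ-≡ (f zbc + f yac + f xab) _ _ (begin
      f axy + ∑ f (map old olds ++ new) + (f zbc + f yac + f xab)
        ≡⟨ cong (λ s → f axy + s + (f zbc + f yac + f xab)) expand ⟩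
      f axy + (O + (f bxz + (K₀ + (f cyz + (K₁ + K₂))))) + (f zbc + f yac + f xab)
        ≡⟨ regroup₁ (f axy) (f bxz) (f cyz) (f xab) (f yac) (f zbc) O K₀ K₁ K₂ ⟩
      O + (f axy + f bxz + f cyz) + (K₀ + f zbc) + (f yac + K₁) + (K₂ + f xab)
        ≡⟨ cong₂ (λ s t → O + (f axy + f bxz + f cyz) + s + (f yac + K₁) + t) (walk₀-count p q) (chain-count p q (2 + k) 0 inner x refl) ⟩
      O + (f axy + f bxz + f cyz) + F₀ + F₁ + (f abc + F₂)
        ≡⟨ regroup₂ O (f axy) (f bxz) (f cyz) F₀ F₁ (f abc) F₂ ⟩
      O + (f axy + f bxz + f cyz + f abc) + (F₀ + (F₁ + F₂))
        ≡⟨ cong (λ s → O + s + (F₀ + (F₁ + F₂))) (trade p q (V x) (V y) (V z) a b c) ⟩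
      O + (f xyz + f xab + f yac + f zbc) + (F₀ + (F₁ + F₂))
        ≡⟨ regroup₃ O (f xyz) (f xab) (f yac) (f zbc) (F₀ + (F₁ + F₂)) ⟩
      f xyz + O + (F₀ + (F₁ + F₂)) + (f zbc + f yac + f xab)
        ≡⟨ cong (λ s → f xyz + O + s + (f zbc + f yac + f xab)) collect ⟨
      f xyz + O + ∑ f (full 0 labels) + (f zbc + f yac + f xab) ∎)
      where
      open ≡-Reasoning
      f = covers p q
      xyz = V x , V y , V z
      abc = a , b , c
      xab = V x , a , b
      yac = V y , a , c
      zbc = V z , b , c
      O = ∑ f (map old olds)
      K₀ = ∑ f (blk z walk₀)
      K₁ = ∑ f (blk y (loop 1 (suc k)))
      K₂ = ∑ f (chain 0 inner x)
      F₀ = ∑ f (blk z (pt 0 ∷ loop 0 (2 + k)))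
      F₁ = ∑ f (blk y (pt 0 ∷ loop 1 (suc k)))
      F₂ = ∑ f (full 2 (inner ∷ʳ x))
      expand : ∑ f (map old olds ++ new) ≡ O + (f bxz + (K₀ + (f cyz + (K₁ + K₂))))
      expand = trans (∑-++ f (map old olds) new) (cong (λ s → O + (f bxz + s))
        (trans (∑-++ f (blk z walk₀) _) (cong (λ s → K₀ + (f cyz + s)) (∑-++ f (blk y (loop 1 (suc k))) _))))
      collect : ∑ f (full 0 labels) ≡ F₀ + (F₁ + F₂)
      collect = trans (cong (λ r → ∑ f (blk z (pt 0 ∷ loop 0 (suc r)) ++ blk y (pt 0 ∷ loop 1 r) ++ full 2 (inner ∷ʳ x))) (suc-injective (suc-injective labels-length)))
        (trans (∑-++ f (blk z (pt 0 ∷ loop 0 (2 + k))) _) (cong (F₀ +_) (∑-++ f (blk y (pt 0 ∷ loop 1 (suc k))) _)))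
      regroup₁ : ∀ axy bxz cyz xab yac zbc O K₀ K₁ K₂ →
        axy + (O + (bxz + (K₀ + (cyz + (K₁ + K₂))))) + (zbc + yac + xab) ≡
        O + (axy + bxz + cyz) + (K₀ + zbc) + (yac + K₁) + (K₂ + xab)
      regroup₁ = solve-∀
      regroup₂ : ∀ O axy bxz cyz F₀ F₁ abc F₂ →
        O + (axy + bxz + cyz) + F₀ + F₁ + (abc + F₂) ≡ O + (axy + bxz + cyz + abc) + (F₀ + (F₁ + F₂))
      regroup₂ = solve-∀
      regroup₃ : ∀ O xyz xab yac zbc F →
        O + (xyz + xab + yac + zbc) + F ≡ xyz + O + F + (zbc + yac + xab)
      regroup₃ = solve-∀

    covers-comm : ∀ p q ts → ∑ (covers p q) ts ≡ ∑ (covers q p) ts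
    covers-comm p q ts = ∑-cong (All.universal (λ t → *-comm (mem p t) (mem q t)) ts)

    ∑-old-W : ∀ p w ts → ∑ (covers p (W w)) (map old ts) ≡ 0
    ∑-old-W p w ts = ∑-zero (Allₚ.map⁺ (All.universal (λ t → *-zeroʳ (mem p (old t))) ts))

    balanced-VW : ∀ i w → IsPoint n w → ∑ (covers (V i) (W w)) blocks ≡ 2
    balanced-VW i w w∈ = trans (∑-blocks (V i) (W w)) (cong₂ _+_ (∑-old-W (V i) w ((x , y , z) ∷ olds))
      (trans (full-VW n w∈ 0 labels labels-length) (cong (_* 2) (labels-once i))))

    -- By `∑-blocks` the count is that of the system before the exchange: there old pairs are
    -- covered by old blocks alone, all other pairs by the cycles alone.
    blocks-balanced : ∀ {p q} → IsPointᵛ n p → IsPointᵛ n q → p ≢ q → ∑ (covers p q) blocks ≡ 2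
    blocks-balanced {V i} {V j} _ _ p≢q = trans (∑-blocks (V i) (V j))
      (cong₂ _+_ (trans (∑-map (covers (V i) (V j)) old ((x , y , z) ∷ olds)) (olds-balanced (p≢q ∘ cong inj₁))) (full-VV (p≢q ∘ cong inj₁) 0 labels))
    blocks-balanced {V i} {W w} _ w∈ _ = balanced-VW i w w∈
    blocks-balanced {W w} {V i} w∈ _ _ = trans (covers-comm (W w) (V i) blocks) (balanced-VW i w w∈)
    blocks-balanced {W w} {W w′} w∈ w′∈ p≢q = trans (∑-blocks (W w) (W w′))
      (cong₂ _+_ (∑-old-W (W w) w′ ((x , y , z) ∷ olds))
        (trans (full-WW w w′ 0 labels) (trans (cong (loops (ιʷ w) (ιʷ w′)) labels-length) (loops-twice n w∈ w′∈ (p≢q ∘ cong inj₂)))))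

  doubled : HamiltonTTS (IsPointᵛ v)
  doubled = subst (λ n → HamiltonTTS (IsPointᵛ n)) n≡v (record
    { first    = axy
    ; rest     = map old olds ++ new
    ; valid    = All.map (λ { {_ , _ , _} p → p }) blocks-valid
    ; distinct = blocks-distinct
    ; length≥3 = s≤s (s≤s (subst (1 ≤_) (sym (Listₚ.length-++ (map old (mid ∷ʳ Bₖ)))) (≤-trans (s≤s z≤n) (m≤n+m _ _))))
    ; cyclic   = blocks-cyclic
    ; balanced = blocks-balanced
    })

-- Labelling the old points and opening the old cycle.

∈⇒↭∷ : {A : Set} {x : A} {xs : List A} → x List.∈ xs → ∃ λ ys → xs ↭ x ∷ ys
∈⇒↭∷ {x = x} x∈xs with ∈-∃++ x∈xs
... | ys , zs , refl = ys ++ zs , ↭ₚ.shift x ys zs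

∈-∷⁻ : {A : Set} {x y : A} {ys : List A} → x ≢ y → x List.∈ y ∷ ys → x List.∈ ys
∈-∷⁻ x≢y (here x≡y)   = ⊥-elim (x≢y x≡y)
∈-∷⁻ x≢y (there x∈ys) = x∈ys

labelling : ∀ {v} {x y z : Fin v} → Distinct (x , y , z) → Labelling x y z
labelling {v} {x} {y} {z} (x≢y , x≢z , y≢z)
  with r₁ , p₁ ← ∈⇒↭∷ (∈-allFin z)
  with r₂ , p₂ ← ∈⇒↭∷ (∈-∷⁻ y≢z (↭ₚ.∈-resp-↭ p₁ (∈-allFin y)))
  with r₃ , p₃ ← ∈⇒↭∷ (∈-∷⁻ x≢y (↭ₚ.∈-resp-↭ p₂ (∈-∷⁻ x≢z (↭ₚ.∈-resp-↭ p₁ (∈-allFin x)))))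
  = record
  { inner = r₃
  ; perm  = ↭-sym (↭-trans p₁ (prep z (↭-trans p₂ (prep y (↭-trans p₃ (↭ₚ.∷↭∷ʳ x r₃))))))
  }

linked-∷ʳ⁻ : {A : Set} {R : A → A → Set} → ∀ xs {b c} →
  Linked R ((xs ∷ʳ b) ∷ʳ c) → Linked R (xs ∷ʳ b) × R b c
linked-∷ʳ⁻ []           (r ∷ [-]) = [-] , r
linked-∷ʳ⁻ (x ∷ [])     (r ∷ rs)  = let rs′ , s = linked-∷ʳ⁻ [] rs in r ∷ rs′ , s
linked-∷ʳ⁻ (x ∷ y ∷ xs) (r ∷ rs)  = let rs′ , s = linked-∷ʳ⁻ (y ∷ xs) rs in r ∷ rs′ , s

two-of-three : ∀ {l m n} → l ≤ 1 → m ≤ 1 → n ≤ 1 → l + m + n ≡ 2 →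
  (l ≡ 1 × m ≡ 1) ⊎ (l ≡ 1 × n ≡ 1) ⊎ (m ≡ 1 × n ≡ 1)
two-of-three (s≤s z≤n) (s≤s z≤n) _         _ = inj₁ (refl , refl)
two-of-three (s≤s z≤n) z≤n       (s≤s z≤n) _ = inj₂ (inj₁ (refl , refl))
two-of-three z≤n       (s≤s z≤n) (s≤s z≤n) _ = inj₂ (inj₂ (refl , refl))
two-of-three (s≤s z≤n) z≤n       z≤n       ()
two-of-three z≤n       (s≤s z≤n) z≤n       ()
two-of-three z≤n       z≤n       (s≤s z≤n) ()
two-of-three z≤n       z≤n       z≤n       ()

arrangement : ∀ {v} → HamiltonTTSᶠ {v} (λ _ → ⊤) → Arrangement v
arrangement record { rest = [] ; length≥3 = s≤s () }
arrangement {v} record { first = B@(p , q , r) ; rest = B₁ ∷ rest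
                       ; distinct = B-distinct@(p≢q , p≢r , q≢r) ∷ ds
                       ; length≥3 = length≥3 ; cyclic = meet₁ ∷ linked ; balanced = balanced }
  with initLast rest
... | [] = ⊥-elim (1+n≰n length≥3)
... | mid ∷ʳ′ Bₖ = choose
      (two-of-three (memᶠ≤1 p d₁) (memᶠ≤1 q d₁) (memᶠ≤1 r d₁) meet₁)
      (two-of-three (memᶠ≤1 p dₖ) (memᶠ≤1 q dₖ) (memᶠ≤1 r dₖ) (trans (commonᶠ-sym B Bₖ) (proj₂ unsnoc)))
  where
  unsnoc = linked-∷ʳ⁻ (B₁ ∷ mid) linked
  d₁ : Distinct B₁
  d₁ = All.head ds
  dₖ : Distinct Bₖ
  dₖ = All.head (Allₚ.++⁻ʳ (B₁ ∷ mid) ds)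

  -- Pair counts depend on B only through its incidences, so its points may be listed in another
  -- order.
  build : ∀ x y z → Distinct (x , y , z) → (∀ i → memᶠ i (x , y , z) ≡ memᶠ i B) →
    memᶠ x B₁ ≡ 1 × memᶠ y B₁ ≡ 1 → memᶠ x Bₖ ≡ 1 × memᶠ z Bₖ ≡ 1 → Arrangement v
  build x y z dist perm (x∈B₁ , y∈B₁) (x∈Bₖ , z∈Bₖ) = record
    { x = x ; y = y ; z = z ; B₁ = B₁ ; Bₖ = Bₖ ; mid = mid
    ; xyz-distinct = dist
    ; x∈B₁ = x∈B₁ ; y∈B₁ = y∈B₁ ; x∈Bₖ = x∈Bₖ ; z∈Bₖ = z∈Bₖ
    ; olds-distinct = ds
    ; olds-linked = proj₁ unsnoc
    ; olds-balanced = λ {i} {j} i≢j → trans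
        (cong (_+ ∑ (coversᶠ i j) (B₁ ∷ mid ∷ʳ Bₖ)) (cong₂ _*_ (perm i) (perm j))) (balanced tt tt i≢j)
    }

  -- The pair {i , j} would lie in the three blocks B, B₁ and Bₖ.
  impossible : ∀ {i j} → i ≢ j → memᶠ i B ≡ 1 → memᶠ j B ≡ 1 →
    memᶠ i B₁ ≡ 1 × memᶠ j B₁ ≡ 1 → memᶠ i Bₖ ≡ 1 × memᶠ j Bₖ ≡ 1 → Arrangement v
  impossible {i} {j} i≢j iB jB (iB₁ , jB₁) (iBₖ , jBₖ) = ⊥-elim (3+n≢2 (∑ f mid) (trans (sym count) (balanced tt tt i≢j)))
    where
    f = coversᶠ i j
    3+n≢2 : ∀ n → ¬ (1 + (1 + (n + 1)) ≡ 2)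
    3+n≢2 n eq with trans (sym (+-comm n 1)) (suc-injective (suc-injective eq))
    ... | ()
    count : ∑ f (B ∷ B₁ ∷ mid ∷ʳ Bₖ) ≡ 1 + (1 + (∑ f mid + 1))
    count = cong₂ _+_ (cong₂ _*_ iB jB) (cong₂ _+_ (cong₂ _*_ iB₁ jB₁)
      (trans (∑-++ f mid (Bₖ ∷ [])) (cong (∑ f mid +_) (trans (+-identityʳ (f Bₖ)) (cong₂ _*_ iBₖ jBₖ)))))

  pB : memᶠ p B ≡ 1
  pB = memᶠ-fst B-distinct
  qB : memᶠ q B ≡ 1
  qB = memᶠ-snd B-distinct
  rB : memᶠ r B ≡ 1
  rB = memᶠ-thd B-distinct

  q≢p : q ≢ p
  q≢p = ≢-sym p≢q
  r≢p : r ≢ p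
  r≢p = ≢-sym p≢r
  r≢q : r ≢ q
  r≢q = ≢-sym q≢r

  qpr : ∀ l m n → m + l + n ≡ l + m + n
  qpr = solve-∀
  prq : ∀ l m n → l + n + m ≡ l + m + n
  prq = solve-∀
  rpq : ∀ l m n → n + l + m ≡ l + m + n
  rpq = solve-∀
  qrp : ∀ l m n → m + n + l ≡ l + m + n
  qrp = solve-∀
  rqp : ∀ l m n → n + m + l ≡ l + m + n
  rqp = solve-∀

  -- `x` is the point of B shared by the pairs in its two neighbours, `y` the other point of the
  -- pair in `B₁` and `z` that of the pair in `Bₖ`. Equal pairs are excluded by `impossible`.
  choose :
    (memᶠ p B₁ ≡ 1 × memᶠ q B₁ ≡ 1) ⊎ (memᶠ p B₁ ≡ 1 × memᶠ r B₁ ≡ 1) ⊎ (memᶠ q B₁ ≡ 1 × memᶠ r B₁ ≡ 1) →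
    (memᶠ p Bₖ ≡ 1 × memᶠ q Bₖ ≡ 1) ⊎ (memᶠ p Bₖ ≡ 1 × memᶠ r Bₖ ≡ 1) ⊎ (memᶠ q Bₖ ≡ 1 × memᶠ r Bₖ ≡ 1) →
    Arrangement v
  choose (inj₁ pq₁)               (inj₁ pqₖ)              = impossible p≢q pB qB pq₁ pqₖ
  choose (inj₁ pq₁)               (inj₂ (inj₁ prₖ))       = build p q r B-distinct (λ _ → refl) pq₁ prₖ
  choose (inj₁ (p₁ , q₁))         (inj₂ (inj₂ qrₖ))       = build q p r (q≢p , q≢r , p≢r) (λ i → qpr (ιᶠ i p) (ιᶠ i q) (ιᶠ i r)) (q₁ , p₁) qrₖ
  choose (inj₂ (inj₁ pr₁))        (inj₁ pqₖ)              = build p r q (p≢r , p≢q , r≢q) (λ i → prq (ιᶠ i p) (ιᶠ i q) (ιᶠ i r)) pr₁ pqₖ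
  choose (inj₂ (inj₁ pr₁))        (inj₂ (inj₁ prₖ))       = impossible p≢r pB rB pr₁ prₖ
  choose (inj₂ (inj₁ (p₁ , r₁)))  (inj₂ (inj₂ (qₖ , rₖ))) = build r p q (r≢p , r≢q , p≢q) (λ i → rpq (ιᶠ i p) (ιᶠ i q) (ιᶠ i r)) (r₁ , p₁) (rₖ , qₖ)
  choose (inj₂ (inj₂ qr₁))        (inj₁ (pₖ , qₖ))        = build q r p (q≢r , q≢p , r≢p) (λ i → qrp (ιᶠ i p) (ιᶠ i q) (ιᶠ i r)) qr₁ (qₖ , pₖ)
  choose (inj₂ (inj₂ (q₁ , r₁)))  (inj₂ (inj₁ (pₖ , rₖ))) = build r q p (r≢q , r≢p , q≢p) (λ i → rqp (ιᶠ i p) (ιᶠ i q) (ιᶠ i r)) (r₁ , q₁) (rₖ , pₖ)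
  choose (inj₂ (inj₂ qr₁))        (inj₂ (inj₂ qrₖ))       = impossible q≢r qB rB qr₁ qrₖ

-- Numbering the points of the doubled system.

module Encoding {v : ℕ} where
  open Blocks {v}

  decode : Fin (v + suc v) → Point v
  decode k with Fin.splitAt v k
  ... | inj₁ i       = V i
  ... | inj₂ zero    = W ∞
  ... | inj₂ (suc j) = W (pt (Fin.toℕ j))

  encode : Point v → Fin (v + suc v)
  encode (V i)      = i Fin.↑ˡ suc v
  encode (W ∞)      = v Fin.↑ʳ zero
  encode (W (pt p)) with p <? v
  ... | yes p<v = v Fin.↑ʳ suc (Fin.fromℕ< p<v)
  -- A default value for numbers that are not points; validity excludes this case in
  -- `decode-encode`.
  ... | no _    = v Fin.↑ʳ zero

  decode-valid : ∀ k → IsPointᵛ v (decode k)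
  decode-valid k with Fin.splitAt v k
  ... | inj₁ i       = tt
  ... | inj₂ zero    = tt
  ... | inj₂ (suc j) = Finₚ.toℕ<n j

  encode-decode : ∀ k → encode (decode k) ≡ k
  encode-decode k with Fin.splitAt v k in eq
  ... | inj₁ i       = Finₚ.splitAt⁻¹-↑ˡ eq
  ... | inj₂ zero    = Finₚ.splitAt⁻¹-↑ʳ eq
  ... | inj₂ (suc j) with Fin.toℕ j <? v
  ... | yes j<v = trans (cong (λ j → v Fin.↑ʳ suc j) (Finₚ.fromℕ<-toℕ j j<v)) (Finₚ.splitAt⁻¹-↑ʳ eq)
  ... | no  j≮v = ⊥-elim (j≮v (Finₚ.toℕ<n j))

  decode-encode : ∀ p → IsPointᵛ v p → decode (encode p) ≡ p
  decode-encode (V i)      _ rewrite Finₚ.splitAt-↑ˡ v i (suc v) = refl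
  decode-encode (W ∞)      _ rewrite Finₚ.splitAt-↑ʳ v (suc v) zero = refl
  decode-encode (W (pt p)) p<v with p <? v
  ... | yes q rewrite Finₚ.splitAt-↑ʳ v (suc v) (suc (Fin.fromℕ< q)) = cong (λ p → W (pt p)) (Finₚ.toℕ-fromℕ< q)
  ... | no ¬q = ⊥-elim (¬q p<v)

  encodeᵗ : Triple (Point v) → Triple (Fin (v + suc v))
  encodeᵗ (a , b , c) = encode a , encode b , encode c

  -- On valid points `encode` and `decode` are mutually inverse, so indicators, and with them all
  -- counts, are carried over unchanged.
  ι-encode : ∀ k {a} → IsPointᵛ v a → ιᶠ k (encode a) ≡ ι (decode k) a
  ι-encode k {a} a∈ with k Finₚ.≟ encode a
  ... | yes refl = sym (trans (cong (λ p → ι p a) (decode-encode a a∈)) (ι-refl a))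
  ... | no  k≢   = sym (ι-≢ {decode k} {a} (λ eq → k≢ (trans (sym (encode-decode k)) (cong encode eq))))

  mem-encode : ∀ k t → IsBlock v t → memᶠ k (encodeᵗ t) ≡ mem (decode k) t
  mem-encode k (a , b , c) (a∈ , b∈ , c∈) = cong₂ _+_ (cong₂ _+_ (ι-encode k a∈) (ι-encode k b∈)) (ι-encode k c∈)

  common-encode : ∀ t u → IsBlock v t → IsBlock v u → commonᶠ (encodeᵗ t) (encodeᵗ u) ≡ common t u
  common-encode (a , b , c) u (a∈ , b∈ , c∈) u∈ = cong₂ _+_ (cong₂ _+_ (point a a∈) (point b b∈)) (point c c∈)
    where
    point : ∀ a → IsPointᵛ v a → memᶠ (encode a) (encodeᵗ u) ≡ mem a u
    point a a∈ = trans (mem-encode (encode a) u u∈) (cong (λ p → mem p u) (decode-encode a a∈))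

  encode-≢ : ∀ {a b} → IsPointᵛ v a → IsPointᵛ v b → a ≢ b → encode a ≢ encode b
  encode-≢ {a} {b} a∈ b∈ a≢b eq = a≢b (trans (sym (decode-encode a a∈)) (trans (cong decode eq) (decode-encode b b∈)))

  encodeTTS : HamiltonTTS (IsPointᵛ v) → HamiltonTTSᶠ {v + suc v} (λ _ → ⊤)
  encodeTTS H = record
    { first    = encodeᵗ first
    ; rest     = map encodeᵗ rest
    ; valid    = All.universal _ (map encodeᵗ blocks)
    ; distinct = Allₚ.map⁺ (All.zipWith
        (λ { {_ , _ , _} ((a∈ , b∈ , c∈) , (a≢b , a≢c , b≢c)) → encode-≢ a∈ b∈ a≢b , encode-≢ a∈ c∈ a≢c , encode-≢ b∈ c∈ b≢c })
        (valid , distinct))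
    ; length≥3 = subst (3 ≤_) (sym (Listₚ.length-map encodeᵗ blocks)) length≥3
    ; cyclic   = subst (Linked Meet₂ᶠ) (Listₚ.map-++ encodeᵗ blocks (first ∷ []))
        (Linkedₚ.map⁺ (linked-map (λ {t} {u} t∈ u∈ eq → trans (common-encode t u t∈ u∈) eq)
          (Allₚ.∷ʳ⁺ valid (All.head valid)) cyclic))
    ; balanced = λ {p} {q} _ _ p≢q → trans (∑-map (coversᶠ p q) encodeᵗ blocks) (trans
        (∑-cong (All.map (λ {t} t∈ → cong₂ _*_ (mem-encode p t t∈) (mem-encode q t t∈)) valid))
        (balanced {decode p} {decode q} (decode-valid p) (decode-valid q)
          (λ eq → p≢q (trans (sym (encode-decode p)) (trans (cong encode eq) (encode-decode q))))))
    }
    where open HamiltonTTS H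

theorem3p1 : (v : ℕ) → (¬ (2 ∣ v) → 7 ≤ v) → (2 ∣ v → 4 ≤ v) →
    ∃ (λ (T : TTS v) → Hamiltonian (2-BIG T)) →
    ∃ (λ (T : TTS (2 * v + 1)) → Hamiltonian (2-BIG T))
theorem3p1 v _ _ T = subst (λ m → ∃ λ (T : TTS m) → Hamiltonian (2-BIG T)) (index v)
  (HamiltonTTS⇒TTS (Encoding.encodeTTS (Doubling.doubled A (labelling (Arrangement.xyz-distinct A)))))
  where
  A : Arrangement v
  A = arrangement (TTS⇒HamiltonTTS T)
  -- The summands are the `v` old points and the `suc v` points of `W`.
  index : ∀ v → v + suc v ≡ 2 * v + 1
  index = solve-∀
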